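{- Let $G$ be a graph, and $Y \subseteq V$. We have $Q_1(G) = Q_1(G*Y)$ when $G*Y$ is defined, and $Q_1(G) = Q_1(G+Y)$. If $\{u,v\}$ is an edge in $G$ with $u \not= v$ where both $u$ and $v$ are non-loop vertices, then \[ Q_1(G) = Q_1(G\setminus u) + Q_1(G\mathbin{\bar{*}} \{u\}\setminus u) + Q_1(G*\{u,v\}\setminus u). \]
   Context: Graphs are undirected without parallel edges, loops allowed, with vertex set $V$; a graph is identified with its symmetric adjacency matrix over $\mathbb{F}_2$ (diagonal entry $1$ iff the vertex has a loop), and $n(\cdot)$ denotes nullity over $\mathbb{F}_2$ (the empty matrix has nullity $0$). $G[X]$ is the induced subgraph (principal submatrix) on $X$ and $G\setminus u = G[V\setminus\{u\}]$. For $X\subseteq V$ with $G[X]$ nonsingular, $G*X$ is the principal pivot transform of the adjacency matrix on $X$ (again a graph), defined only in that case. $G+X$ is loop complementation: toggle the loops at the vertices of $X$. The dual pivot is $G\mathbin{\bar{*}} X = G+X*X+X$, defined when the pivot inside is defined; operations are applied left to right. The polynomial is $Q_1(G) = \sum_{X\subseteq V} \sum_{Z\subseteq X} y^{n((G+Z)[X])}$. -}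

module Defs where

open import Data.Bool using (Bool; true; false; _∧_; _∨_; _xor_; not; if_then_else_)
open import Data.Nat using (ℕ; zero; suc; _+_; _∸_; _≡ᵇ_)
open import Data.Fin using (Fin; zero; suc; punchIn; _≟_)
open import Data.List using (List; []; _∷_; map; foldr; allFin; concatMap)
open import Data.Nat.ListAction using (sum)
open import Relation.Nullary.Decidable using (⌊_⌋)
open import Relation.Binary.PropositionalEquality using (_≡_)
open import Data.Product using (_×_)

-- Linear algebra over F₂ = Bool (xor = +, ∧ = ·)

Vect : ℕ → Set
Vect n = Fin n → Bool

Subset : ℕ → Set
Subset n = Fin n → Bool

-- adjacency matrices over F₂ on vertex set Fin n (diagonal = loops)
Mat : ℕ → Set
Mat n = Fin n → Fin n → Bool

Symmetric : ∀ {n} → Mat n → Set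
Symmetric G = ∀ i j → G i j ≡ G j i

Σ₂ : ∀ {n} → (Fin n → Bool) → Bool
Σ₂ {n} f = foldr _xor_ false (map f (allFin n))

Σ₂[_] : ∀ {n} → Subset n → (Fin n → Bool) → Bool
Σ₂[ X ] f = Σ₂ (λ k → X k ∧ f k)

card : ∀ {n} → Subset n → ℕ
card {n} X = sum (map (λ i → if X i then 1 else 0) (allFin n))

⟦_⟧ : ∀ {n} → Fin n → Subset n
⟦ u ⟧ i = ⌊ i ≟ u ⌋

⟦_,_⟧ : ∀ {n} → Fin n → Fin n → Subset n
⟦ u , v ⟧ i = ⌊ i ≟ u ⌋ ∨ ⌊ i ≟ v ⌋

data PivotSearch (m : ℕ) : Set where
  none  : PivotSearch m
  found : Vect (suc m) → List (Vect (suc m)) → PivotSearch m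

findPivot : ∀ {m} → List (Vect (suc m)) → PivotSearch m
findPivot [] = none
findPivot (r ∷ rs) with r zero
... | true  = found r rs
... | false with findPivot rs
...   | none        = none
...   | found p ps  = found p (r ∷ ps)

dropCol : ∀ {m} → Vect (suc m) → Vect m
dropCol r i = r (suc i)

rankRows : (m : ℕ) → List (Vect m) → ℕ
rankRows zero    rs = 0
rankRows (suc m) rs with findPivot rs
... | none       = rankRows m (map dropCol rs)
... | found p ps = suc (rankRows m (map (λ s → dropCol (if s zero then (λ i → s i xor p i) else s)) ps))

rank : ∀ {n} → Mat n → ℕ
rank {n} A = rankRows n (map A (allFin n))

-- the principal submatrix G[X], padded with zeros outside X × X
-- (padding with zero rows/columns does not change the rank)
restrict : ∀ {n} → Mat n → Subset n → Mat n
restrict G X i j = X i ∧ X j ∧ G i j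

nullity : ∀ {n} → Mat n → Subset n → ℕ
nullity G X = card X ∸ rank (restrict G X)

_⊕_ : ∀ {n} → Mat n → Subset n → Mat n
(G ⊕ X) i j = if ⌊ i ≟ j ⌋ ∧ X i then not (G i j) else G i j

_∖_ : ∀ {n} → Mat (suc n) → Fin (suc n) → Mat n
(G ∖ u) i j = G (punchIn u i) (punchIn u j)

-- B is the inverse of G[X] (only the X × X block of B is relevant).
-- Such B exists iff G[X] is nonsingular, and then it is unique on X × X.
IsInverseOn : ∀ {n} → Mat n → Subset n → Mat n → Set
IsInverseOn G X B =
  (∀ i j → X i ≡ true → X j ≡ true → Σ₂[ X ] (λ k → B i k ∧ G k j) ≡ ⌊ i ≟ j ⌋) ×
  (∀ i j → X i ≡ true → X j ≡ true → Σ₂[ X ] (λ k → G i k ∧ B k j) ≡ ⌊ i ≟ j ⌋)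

-- principal pivot transform G * X, given the inverse B of G[X]:
--  with G = [[P, Q], [R, S]] (X first), G * X = [[P⁻¹, -P⁻¹Q], [RP⁻¹, S - RP⁻¹Q]]
-- (signs are irrelevant over F₂)
pivot : ∀ {n} → Mat n → Subset n → Mat n → Mat n
pivot G X B i j with X i | X j
... | true  | true  = B i j
... | true  | false = Σ₂[ X ] (λ k → B i k ∧ G k j)
... | false | true  = Σ₂[ X ] (λ k → G i k ∧ B k j)
... | false | false = G i j xor Σ₂[ X ] (λ k → G i k ∧ Σ₂[ X ] (λ l → B k l ∧ G l j))

-- The polynomial Q₁, represented by its coefficient sequence:
-- Q₁ G k = coefficient of y^k = #{ (X, Z) : Z ⊆ X ⊆ V, n((G+Z)[X]) = k }.

subsets : (n : ℕ) → List (Subset n)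
subsets zero    = (λ ()) ∷ []
subsets (suc n) = concatMap (λ b → map (λ s → cons b s) (subsets n)) (true ∷ false ∷ [])
  where
  cons : Bool → Subset n → Subset (suc n)
  cons b s zero    = b
  cons b s (suc i) = s i

_⊆ᵇ_ : ∀ {n} → Subset n → Subset n → Bool
_⊆ᵇ_ {n} Z X = foldr _∧_ true (map (λ i → not (Z i) ∨ X i) (allFin n))

Poly : Set
Poly = ℕ → ℕ

Q₁ : ∀ {n} → Mat n → Poly
Q₁ {n} G k =
  sum (map (λ X → sum (map (λ Z → if (Z ⊆ᵇ X) ∧ (nullity (G ⊕ Z) X ≡ᵇ k) then 1 else 0)
                           (subsets n)))
           (subsets n))

_+ₚ_ : Poly → Poly → Poly
(p +ₚ q) k = p k + q k

-- Q₁ G sums y^n((G+Z)[X]) over the pairs Z ⊆ X, and 2^n(M[X]) is the number of vectors supported on X that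
-- M[X] annihilates (the Gaussian elimination defining rank gives #solutions · 2^rank = 2^#columns).
-- Loop complementation by Y maps a pair (X, Z) to (X, Z Δ (Y ∩ X)), since (G+Y+Z)[X] = (G + Z Δ (Y ∩ X))[X].
-- Pivoting on Y maps it to (X Δ (Y ∖ Z), Z): exchanging the Y-coordinates of z and (G*Y) z carries the kernel
-- of (G*Y + Z)[X] bijectively onto that of (G + Z)[X Δ (Y ∖ Z)]. Both maps are involutions on pairs, so Q₁ is
-- invariant. For the recurrence the pairs are split by whether u ∈ X and u ∈ Z: those with u ∉ X give
-- Q₁(G ∖ u), those with u ∈ Z ⊆ X correspond to the pairs of the dual pivot on {u} minus u, and those with
-- u ∈ X ∖ Z to the pairs of G * {u,v} ∖ u.

module Submission where

open import Defs
open import Algebra.Bundles using (CommutativeMonoid; CommutativeRing)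
open import Data.Bool using (Bool; true; false; _∧_; _∨_; _xor_; not; if_then_else_)
import Data.Bool as Bool
open import Data.Bool.ListAction using (and; all)
open import Data.Bool.Properties
  using (xor-∧-commutativeRing; ∧-commutativeMonoid; ∧-conicalˡ; ∧-conicalʳ;
         ∧-distribʳ-xor; xor-assoc; xor-comm; xor-same; xor-identityʳ; ∧-zeroʳ; ∧-identityʳ; ∧-assoc; ∨-zeroʳ; not-involutive)
open import Data.Fin using (Fin; zero; suc; punchIn; punchOut; _≟_)
open import Data.Fin.Properties using (punchInᵢ≢i; punchIn-injective; punchIn-punchOut)
import Data.List as List
open import Data.Nat using (ℕ; zero; suc; _+_; _*_; _∸_; _^_; _≡ᵇ_)
open import Data.Nat.Properties
  using (+-commutativeSemigroup; +-comm; +-assoc; *-distribˡ-+; *-distribʳ-+; *-assoc; *-comm; +-identityʳ; *-identityʳ;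
         *-cancelˡ-≡; m*n≡1⇒m≡1; m*n≡1⇒n≡1; m^n≢0; ^-distribˡ-+-*)
open import Data.List.Properties using (map-++; map-∘; map-cong)
open import Data.Nat.ListAction using () renaming (sum to sumᴸ)
open import Data.Nat.Logarithm using (⌊log₂_⌋; ⌊log₂[2^n]⌋≡n)
open import Data.Nat.ListAction.Properties using () renaming (sum-++ to sumᴸ-++)
open import Data.Product using (_×_; proj₁; proj₂)
import Data.Product as Product
open import Data.Vec.Functional using (_∷_; insertAt; removeAt)
open import Data.Vec.Functional.Properties using (insertAt-lookup; insertAt-punchIn)
import Data.Vec.Functional as Vector
open import Function using (_∘_; id)
open import Relation.Binary.Core using (_Preserves_⟶_)
open import Relation.Binary.PropositionalEquality
open import Relation.Nullary using (¬_; yes; no; contradiction)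
open import Relation.Nullary.Decidable using (⌊_⌋)

private
  variable
    n : ℕ

cong₃ : ∀ {A B C D : Set} (f : A → B → C → D) {a a′ b b′ c c′} → a ≡ a′ → b ≡ b′ → c ≡ c′ → f a b c ≡ f a′ b′ c′
cong₃ f refl refl refl = refl

open CommutativeRing xor-∧-commutativeRing using (semiring)
open import Algebra.Properties.CommutativeSemigroup +-commutativeSemigroup using (interchange)
open import Algebra.Properties.CommutativeSemigroup (CommutativeMonoid.commutativeSemigroup ∧-commutativeMonoid)
  using () renaming (x∙yz≈y∙xz to ∧-swap)
open import Algebra.Properties.CommutativeMonoid.Sum ∧-commutativeMonoid
  using () renaming (sum to ⋀; sum-cong-≗ to ⋀-cong; sum-remove to ⋀-remove)
open import Algebra.Properties.Semiring.Sum semiring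
  using (sum; sum-cong-≗; ∑-distrib-+; ∑-comm; sum-remove; sum-replicate-zero; *-distribˡ-sum; *-distribʳ-sum)

-- Sums over Fin n in 𝔽₂

foldr-map-tabulate : ∀ {A B : Set} (c : A → B → B) (e : B) (f : Fin n → A) {m} (g : Fin m → Fin n) →
                     List.foldr c e (List.map f (List.tabulate g)) ≡ Vector.foldr c e (f ∘ g)
foldr-map-tabulate c e f {zero}  g = refl
foldr-map-tabulate c e f {suc m} g = cong (c (f (g zero))) (foldr-map-tabulate c e f (g ∘ suc))

Σ₂≡sum : (f : Fin n → Bool) → Σ₂ f ≡ sum f
Σ₂≡sum f = foldr-map-tabulate _xor_ false f id

Σ₂-cong : {f g : Fin n → Bool} → f ≗ g → Σ₂ f ≡ Σ₂ g
Σ₂-cong {f = f} {g} f≗g = trans (Σ₂≡sum f) (trans (sum-cong-≗ f≗g) (sym (Σ₂≡sum g)))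

Σ₂-xor : (f g : Fin n → Bool) → Σ₂ (λ j → f j xor g j) ≡ Σ₂ f xor Σ₂ g
Σ₂-xor f g = trans (Σ₂≡sum (λ j → f j xor g j)) (trans (∑-distrib-+ f g) (sym (cong₂ _xor_ (Σ₂≡sum f) (Σ₂≡sum g))))

Σ₂-∧ˡ : (a : Bool) (f : Fin n → Bool) → Σ₂ (λ j → a ∧ f j) ≡ a ∧ Σ₂ f
Σ₂-∧ˡ a f = trans (Σ₂≡sum (λ j → a ∧ f j)) (trans (sym (*-distribˡ-sum a f)) (cong (a ∧_) (sym (Σ₂≡sum f))))

Σ₂-∧ʳ : (a : Bool) (f : Fin n → Bool) → Σ₂ (λ j → f j ∧ a) ≡ Σ₂ f ∧ a
Σ₂-∧ʳ a f = trans (Σ₂≡sum (λ j → f j ∧ a)) (trans (sym (*-distribʳ-sum a f)) (cong (_∧ a) (sym (Σ₂≡sum f))))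

Σ₂-comm : ∀ {m} (f : Fin n → Fin m → Bool) → Σ₂ (λ i → Σ₂ (f i)) ≡ Σ₂ (λ j → Σ₂ (λ i → f i j))
Σ₂-comm f = begin
  Σ₂ (λ i → Σ₂ (f i))            ≡⟨ Σ₂-cong (λ i → Σ₂≡sum (f i)) ⟩
  Σ₂ (λ i → sum (f i))           ≡⟨ Σ₂≡sum (λ i → sum (f i)) ⟩
  sum (λ i → sum (f i))          ≡⟨ ∑-comm f ⟩
  sum (λ j → sum (λ i → f i j))  ≡⟨ sym (Σ₂≡sum (λ j → sum (λ i → f i j))) ⟩
  Σ₂ (λ j → sum (λ i → f i j))   ≡⟨ Σ₂-cong (λ j → sym (Σ₂≡sum (λ i → f i j))) ⟩
  Σ₂ (λ j → Σ₂ (λ i → f i j))    ∎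
  where open ≡-Reasoning

Σ₂-remove : (u : Fin (suc n)) (f : Fin (suc n) → Bool) → Σ₂ f ≡ f u xor Σ₂ (removeAt f u)
Σ₂-remove u f = trans (Σ₂≡sum f) (trans (sum-remove f) (cong (f u xor_) (sym (Σ₂≡sum (removeAt f u)))))

Σ₂-zero : {f : Fin n → Bool} → (∀ i → f i ≡ false) → Σ₂ f ≡ false
Σ₂-zero {n} {f} f≡0 = trans (Σ₂≡sum f) (trans (sum-cong-≗ {y = λ _ → false} f≡0) (sum-replicate-zero n))

⌊≟⌋-refl : (i : Fin n) → ⌊ i ≟ i ⌋ ≡ true
⌊≟⌋-refl i with i ≟ i
... | yes _ = refl
... | no i≢i = contradiction refl i≢i

⌊≟⌋-≢ : {i j : Fin n} → i ≢ j → ⌊ i ≟ j ⌋ ≡ false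
⌊≟⌋-≢ {i = i} {j} i≢j with i ≟ j
... | yes i≡j = contradiction i≡j i≢j
... | no _    = refl

Σ₂-δ : (i : Fin n) (f : Fin n → Bool) → Σ₂ (λ j → ⌊ i ≟ j ⌋ ∧ f j) ≡ f i
Σ₂-δ {suc n} i f = begin
  Σ₂ (λ j → ⌊ i ≟ j ⌋ ∧ f j)                                         ≡⟨ Σ₂-remove i (λ j → ⌊ i ≟ j ⌋ ∧ f j) ⟩
  (⌊ i ≟ i ⌋ ∧ f i) xor Σ₂ (λ j → ⌊ i ≟ punchIn i j ⌋ ∧ f (punchIn i j))
    ≡⟨ cong₂ _xor_ (cong (_∧ f i) (⌊≟⌋-refl i)) (Σ₂-zero (λ j → cong (_∧ f (punchIn i j)) (⌊≟⌋-≢ (punchInᵢ≢i i j ∘ sym)))) ⟩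
  f i xor false                                                      ≡⟨ xor-identityʳ (f i) ⟩
  f i                                                                ∎
  where open ≡-Reasoning

⋀-true : {f : Fin n → Bool} → ⋀ f ≡ true → ∀ i → f i ≡ true
⋀-true {f = f} p zero    = ∧-conicalˡ (f zero) _ p
⋀-true {f = f} p (suc i) = ⋀-true (∧-conicalʳ (f zero) _ p) i

⋀-intro : {f : Fin n → Bool} → (∀ i → f i ≡ true) → ⋀ f ≡ true
⋀-intro {zero}  p = refl
⋀-intro {suc n} p = cong₂ _∧_ (p zero) (⋀-intro (p ∘ suc))

-- Sums over 𝔽₂ⁿ

𝟙 : Bool → ℕ
𝟙 b = if b then 1 else 0

𝟙-∧ : ∀ a b m → 𝟙 (a ∧ b) * m ≡ 𝟙 a * (𝟙 b * m)
𝟙-∧ false b m = refl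
𝟙-∧ true  b m = sym (+-identityʳ _)

𝟙-* : ∀ a b → 𝟙 a * 𝟙 b ≡ 𝟙 (a ∧ b)
𝟙-* false b = refl
𝟙-* true  b = +-identityʳ (𝟙 b)

∑ᵥ : (n : ℕ) → (Vect n → ℕ) → ℕ
∑ᵥ zero    f = f (λ ())
∑ᵥ (suc n) f = ∑ᵥ n (λ x → f (true ∷ x)) + ∑ᵥ n (λ x → f (false ∷ x))

∑ᵥ-cong : {f g : Vect n → ℕ} → (∀ x → f x ≡ g x) → ∑ᵥ n f ≡ ∑ᵥ n g
∑ᵥ-cong {zero}  f≡g = f≡g _
∑ᵥ-cong {suc n} f≡g = cong₂ _+_ (∑ᵥ-cong (f≡g ∘ (true ∷_))) (∑ᵥ-cong (f≡g ∘ (false ∷_)))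

∑ᵥ-zero : {f : Vect n → ℕ} → (∀ x → f x ≡ 0) → ∑ᵥ n f ≡ 0
∑ᵥ-zero {zero}  f≡0 = f≡0 _
∑ᵥ-zero {suc n} f≡0 = cong₂ _+_ (∑ᵥ-zero (f≡0 ∘ (true ∷_))) (∑ᵥ-zero (f≡0 ∘ (false ∷_)))

∑ᵥ-distrib-+ : (f g : Vect n → ℕ) → ∑ᵥ n (λ x → f x + g x) ≡ ∑ᵥ n f + ∑ᵥ n g
∑ᵥ-distrib-+ {zero}  f g = refl
∑ᵥ-distrib-+ {suc n} f g =
  trans (cong₂ _+_ (∑ᵥ-distrib-+ (f ∘ (true ∷_)) (g ∘ (true ∷_))) (∑ᵥ-distrib-+ (f ∘ (false ∷_)) (g ∘ (false ∷_))))
        (interchange (∑ᵥ n (f ∘ (true ∷_))) (∑ᵥ n (g ∘ (true ∷_))) (∑ᵥ n (f ∘ (false ∷_))) (∑ᵥ n (g ∘ (false ∷_))))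

∑ᵥ-*ˡ : (c : ℕ) (f : Vect n → ℕ) → ∑ᵥ n (λ x → c * f x) ≡ c * ∑ᵥ n f
∑ᵥ-*ˡ {zero}  c f = refl
∑ᵥ-*ˡ {suc n} c f = trans (cong₂ _+_ (∑ᵥ-*ˡ c (f ∘ (true ∷_))) (∑ᵥ-*ˡ c (f ∘ (false ∷_)))) (sym (*-distribˡ-+ c _ _))

∑ᵥ-comm : ∀ {m} (f : Vect n → Vect m → ℕ) → ∑ᵥ n (λ x → ∑ᵥ m (f x)) ≡ ∑ᵥ m (λ y → ∑ᵥ n (λ x → f x y))
∑ᵥ-comm {zero}  f = refl
∑ᵥ-comm {suc n} f = trans (cong₂ _+_ (∑ᵥ-comm (f ∘ (true ∷_))) (∑ᵥ-comm (f ∘ (false ∷_))))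
                          (sym (∑ᵥ-distrib-+ (λ y → ∑ᵥ n (λ x → f (true ∷ x) y)) (λ y → ∑ᵥ n (λ x → f (false ∷ x) y))))

∑ᵥ-insertAt : (u : Fin (suc n)) (f : Vect (suc n) → ℕ) → f Preserves _≗_ ⟶ _≡_ →
              ∑ᵥ (suc n) f ≡ ∑ᵥ n (λ x → f (insertAt x u true)) + ∑ᵥ n (λ x → f (insertAt x u false))
∑ᵥ-insertAt {n} zero f f-ext =
  cong₂ _+_ (∑ᵥ-cong {n} λ x → f-ext λ { zero → refl ; (suc i) → refl })
            (∑ᵥ-cong {n} λ x → f-ext λ { zero → refl ; (suc i) → refl })
∑ᵥ-insertAt {suc n} (suc u) f f-ext = begin
  ∑ᵥ (suc n) (f ∘ (true ∷_)) + ∑ᵥ (suc n) (f ∘ (false ∷_))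
    ≡⟨ cong₂ _+_ (∑ᵥ-insertAt u (f ∘ (true ∷_)) (f-ext ∘ ∷-cong true))
                 (∑ᵥ-insertAt u (f ∘ (false ∷_)) (f-ext ∘ ∷-cong false)) ⟩
  (part true true + part true false) + (part false true + part false false)
    ≡⟨ interchange (part true true) (part true false) (part false true) (part false false) ⟩
  (part true true + part false true) + (part true false + part false false)
    ≡⟨ cong₂ _+_ (cong₂ _+_ (swap true true) (swap false true)) (cong₂ _+_ (swap true false) (swap false false)) ⟩
  ∑ᵥ (suc n) (λ x → f (insertAt x (suc u) true)) + ∑ᵥ (suc n) (λ x → f (insertAt x (suc u) false)) ∎
  where
  open ≡-Reasoning
  part : Bool → Bool → ℕ
  part c b = ∑ᵥ n (λ x → f (c ∷ insertAt x u b))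
  ∷-cong : ∀ c {x y : Vect (suc n)} → x ≗ y → (c ∷ x) ≗ (c ∷ y)
  ∷-cong c x≗y zero    = refl
  ∷-cong c x≗y (suc i) = x≗y i
  swap : ∀ c b → part c b ≡ ∑ᵥ n (λ x → f (insertAt (c ∷ x) (suc u) b))
  swap c b = ∑ᵥ-cong {n} λ x → f-ext λ { zero → refl ; (suc i) → refl }

∑ᵥ-subsets : (f : Subset n → ℕ) → f Preserves _≗_ ⟶ _≡_ → sumᴸ (List.map f (subsets n)) ≡ ∑ᵥ n f
∑ᵥ-subsets {zero}  f f-ext = +-identityʳ _
∑ᵥ-subsets {suc n} f f-ext =
  trans (sumᴸ-map-++ (List.map _ (subsets n)) (List.map _ (subsets n)))
        (cong₂ _+_ (half true λ x → λ { zero → refl ; (suc i) → refl })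
                   (half false λ x → λ { zero → refl ; (suc i) → refl }))
  where
  sumᴸ-map-++ : (xs ys : List.List (Subset (suc n))) →
                sumᴸ (List.map f (xs List.++ (ys List.++ List.[]))) ≡ sumᴸ (List.map f xs) + sumᴸ (List.map f ys)
  sumᴸ-map-++ xs ys = begin
    sumᴸ (List.map f (xs List.++ (ys List.++ List.[])))              ≡⟨ cong sumᴸ (map-++ f xs _) ⟩
    sumᴸ (List.map f xs List.++ List.map f (ys List.++ List.[]))     ≡⟨ sumᴸ-++ (List.map f xs) _ ⟩
    sumᴸ (List.map f xs) + sumᴸ (List.map f (ys List.++ List.[]))    ≡⟨ cong (λ zs → sumᴸ (List.map f xs) + sumᴸ zs) (map-++ f ys List.[]) ⟩
    sumᴸ (List.map f xs) + sumᴸ (List.map f ys List.++ List.[])      ≡⟨ cong (sumᴸ (List.map f xs) +_) (trans (sumᴸ-++ (List.map f ys) List.[]) (+-identityʳ _)) ⟩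
    sumᴸ (List.map f xs) + sumᴸ (List.map f ys)                      ∎
    where open ≡-Reasoning
  -- subsets (suc n) prefixes the bit by a function local to its definition, which agrees with _∷_ only pointwise
  half : ∀ b {h : Subset n → Subset (suc n)} → (∀ x → h x ≗ (b ∷ x)) →
         sumᴸ (List.map f (List.map h (subsets n))) ≡ ∑ᵥ n (λ x → f (b ∷ x))
  half b {h} h≗∷ = begin
    sumᴸ (List.map f (List.map h (subsets n)))  ≡⟨ cong sumᴸ (sym (map-∘ (subsets n))) ⟩
    sumᴸ (List.map (f ∘ h) (subsets n))         ≡⟨ ∑ᵥ-subsets (f ∘ h) (λ {x} {y} x≗y → f-ext (λ i → trans (h≗∷ x i) (trans (∷-cong x≗y i) (sym (h≗∷ y i))))) ⟩
    ∑ᵥ n (f ∘ h)                                ≡⟨ ∑ᵥ-cong (λ x → f-ext (h≗∷ x)) ⟩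
    ∑ᵥ n (λ x → f (b ∷ x))                      ∎
    where
    open ≡-Reasoning
    ∷-cong : {x y : Subset n} → x ≗ y → (b ∷ x) ≗ (b ∷ y)
    ∷-cong x≗y zero    = refl
    ∷-cong x≗y (suc i) = x≗y i

_≐_ : Vect n → Vect n → Bool
x ≐ y = ⋀ (λ i → ⌊ x i Bool.≟ y i ⌋)

≐-sound : {x y : Vect n} → x ≐ y ≡ true → x ≗ y
≐-sound x≐y i = bit (⋀-true x≐y i)
  where
  bit : ∀ {a b} → ⌊ a Bool.≟ b ⌋ ≡ true → a ≡ b
  bit {false} {false} _ = refl
  bit {true}  {true}  _ = refl

≐-complete : {x y : Vect n} → x ≗ y → x ≐ y ≡ true
≐-complete x≗y = ⋀-intro λ i → subst (λ b → ⌊ _ Bool.≟ b ⌋ ≡ true) (x≗y i) (bit _)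
  where
  bit : ∀ a → ⌊ a Bool.≟ a ⌋ ≡ true
  bit false = refl
  bit true  = refl

∑ᵥ-δ : (a : Vect n) (f : Vect n → ℕ) → f Preserves _≗_ ⟶ _≡_ → ∑ᵥ n (λ x → 𝟙 (a ≐ x) * f x) ≡ f a
∑ᵥ-δ {zero}  a f f-ext = trans (+-identityʳ _) (f-ext λ ())
∑ᵥ-δ {suc n} a f f-ext = trans (cong₂ _+_ (branch true) (branch false)) (select (a zero) refl)
  where
  a′ = a ∘ suc
  branch : ∀ b → ∑ᵥ n (λ x → 𝟙 (a ≐ (b ∷ x)) * f (b ∷ x)) ≡ 𝟙 ⌊ a zero Bool.≟ b ⌋ * f (b ∷ a′)
  branch b = begin
    ∑ᵥ n (λ x → 𝟙 (⌊ a zero Bool.≟ b ⌋ ∧ (a′ ≐ x)) * f (b ∷ x))  ≡⟨ ∑ᵥ-cong (λ x → 𝟙-∧ ⌊ a zero Bool.≟ b ⌋ (a′ ≐ x) _) ⟩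
    ∑ᵥ n (λ x → 𝟙 ⌊ a zero Bool.≟ b ⌋ * (𝟙 (a′ ≐ x) * f (b ∷ x)))  ≡⟨ ∑ᵥ-*ˡ (𝟙 ⌊ a zero Bool.≟ b ⌋) (λ x → 𝟙 (a′ ≐ x) * f (b ∷ x)) ⟩
    𝟙 ⌊ a zero Bool.≟ b ⌋ * ∑ᵥ n (λ x → 𝟙 (a′ ≐ x) * f (b ∷ x))   ≡⟨ cong (𝟙 ⌊ a zero Bool.≟ b ⌋ *_) (∑ᵥ-δ a′ (f ∘ (b ∷_)) (λ x≗y → f-ext λ { zero → refl ; (suc i) → x≗y i })) ⟩
    𝟙 ⌊ a zero Bool.≟ b ⌋ * f (b ∷ a′)                              ∎
    where open ≡-Reasoning
  select : ∀ c → a zero ≡ c → 𝟙 ⌊ c Bool.≟ true ⌋ * f (true ∷ a′) + 𝟙 ⌊ c Bool.≟ false ⌋ * f (false ∷ a′) ≡ f a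
  select true  a₀≡c = trans (+-identityʳ _) (trans (+-identityʳ _) (f-ext λ { zero → sym a₀≡c ; (suc i) → refl }))
  select false a₀≡c = trans (+-identityʳ _) (f-ext λ { zero → sym a₀≡c ; (suc i) → refl })

xor-cancelʳ : ∀ a r → (a xor r) xor r ≡ a
xor-cancelʳ a r = trans (xor-assoc a r r) (trans (cong (a xor_) (xor-same r)) (xor-identityʳ a))

bool-ext : {a b : Bool} → (a ≡ true → b ≡ true) → (b ≡ true → a ≡ true) → a ≡ b
bool-ext {false} {false} _ _ = refl
bool-ext {false} {true}  _ b⇒a = b⇒a refl
bool-ext {true}  {false} a⇒b _ = sym (a⇒b refl)
bool-ext {true}  {true}  _ _ = refl

-- The proof exchanges the order of summation in ∑ₓ ∑ᵧ [ψ x = y] f y.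
∑ᵥ-bijection : (f : Vect n → ℕ) → f Preserves _≗_ ⟶ _≡_ →
               (ψ φ : Vect n → Vect n) → ψ Preserves _≗_ ⟶ _≗_ → φ Preserves _≗_ ⟶ _≗_ →
               (∀ x → φ (ψ x) ≗ x) → (∀ y → ψ (φ y) ≗ y) → ∑ᵥ n (f ∘ ψ) ≡ ∑ᵥ n f
∑ᵥ-bijection {n} f f-ext ψ φ ψ-cong φ-cong φψ ψφ = begin
  ∑ᵥ n (λ x → f (ψ x))                              ≡⟨ ∑ᵥ-cong (λ x → sym (∑ᵥ-δ (ψ x) f f-ext)) ⟩
  ∑ᵥ n (λ x → ∑ᵥ n (λ y → 𝟙 (ψ x ≐ y) * f y))       ≡⟨ ∑ᵥ-cong (λ x → ∑ᵥ-cong (λ y → cong (λ b → 𝟙 b * f y) (transpose x y))) ⟩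
  ∑ᵥ n (λ x → ∑ᵥ n (λ y → 𝟙 (φ y ≐ x) * f y))       ≡⟨ ∑ᵥ-comm (λ x y → 𝟙 (φ y ≐ x) * f y) ⟩
  ∑ᵥ n (λ y → ∑ᵥ n (λ x → 𝟙 (φ y ≐ x) * f y))       ≡⟨ ∑ᵥ-cong (λ y → ∑ᵥ-δ (φ y) (λ _ → f y) (λ _ → refl)) ⟩
  ∑ᵥ n f                                            ∎
  where
  open ≡-Reasoning
  transpose : ∀ x y → ψ x ≐ y ≡ φ y ≐ x
  transpose x y = bool-ext
    (λ ψx≐y → ≐-complete λ i → trans (sym (φ-cong (≐-sound ψx≐y) i)) (φψ x i))
    (λ φy≐x → ≐-complete λ i → trans (sym (ψ-cong (≐-sound φy≐x) i)) (ψφ y i))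

∑ᵥ-translate : (c : Vect n) (f : Vect n → ℕ) → f Preserves _≗_ ⟶ _≡_ → ∑ᵥ n (λ x → f (λ i → x i xor c i)) ≡ ∑ᵥ n f
∑ᵥ-translate c f f-ext = ∑ᵥ-bijection f f-ext translate translate translate-cong translate-cong cancel cancel
  where
  translate : Vect _ → Vect _
  translate x i = x i xor c i
  translate-cong : translate Preserves _≗_ ⟶ _≗_
  translate-cong x≗y i = cong (_xor c i) (x≗y i)
  cancel : ∀ x → translate (translate x) ≗ x
  cancel x i = xor-cancelʳ (x i) (c i)

-- Gaussian elimination

infix 8 _·_

_·_ : Vect n → Vect n → Bool
r · x = Σ₂ (λ j → r j ∧ x j)

·-∷ : (r : Vect (suc n)) (b : Bool) (x : Vect n) → r · (b ∷ x) ≡ (r zero ∧ b) xor (dropCol r · x)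
·-∷ r b x = Σ₂-remove zero (λ j → r j ∧ (b ∷ x) j)

·-xorˡ : (r s x : Vect n) → (λ j → r j xor s j) · x ≡ (r · x) xor (s · x)
·-xorˡ r s x = trans (Σ₂-cong (λ j → ∧-distribʳ-xor (x j) (r j) (s j))) (Σ₂-xor (λ j → r j ∧ x j) (λ j → s j ∧ x j))

solves : ∀ {m} → List.List (Vect m) → Vect m → Bool
solves rs x = all (λ r → not (r · x)) rs

solutionCount : (m : ℕ) → List.List (Vect m) → ℕ
solutionCount m rs = ∑ᵥ m (λ x → 𝟙 (solves rs x))

data PivotView (rs : List.List (Vect (suc n))) : PivotSearch n → Set where
  none  : (∀ b x → solves rs (b ∷ x) ≡ solves (List.map dropCol rs) x) → PivotView rs none
  found : ∀ {p ps} → p zero ≡ true → (∀ x → solves rs x ≡ solves (p List.∷ ps) x) → PivotView rs (found p ps)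

pivotView : (rs : List.List (Vect (suc n))) → PivotView rs (findPivot rs)
pivotView List.[] = none λ _ _ → refl
pivotView (r List.∷ rs) with r zero in r₀≡
... | true  = found r₀≡ λ _ → refl
... | false with findPivot rs | pivotView rs
...   | none       | none rs≡  = none λ b x →
          cong₂ _∧_ (cong not (trans (·-∷ r b x) (cong (λ c → (c ∧ b) xor (dropCol r · x)) r₀≡))) (rs≡ b x)
...   | found p ps | found p₀≡ rs≡ = found p₀≡ λ x →
          trans (cong (not (r · x) ∧_) (rs≡ x)) (∧-swap (not (r · x)) (not (p · x)) _)

eliminate : Vect (suc n) → Vect (suc n) → Vect n
eliminate p s = dropCol (if s zero then (λ i → s i xor p i) else s)

eliminate-· : (p s x : Vect (suc n)) → p zero ≡ true → p · x ≡ false → eliminate p s · dropCol x ≡ s · x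
eliminate-· p s x p₀≡1 p·x≡0 = reduce (s zero) refl
  where
  open ≡-Reasoning
  s′ = λ i → s i xor p i
  reduce : ∀ c → s zero ≡ c → dropCol (if c then s′ else s) · dropCol x ≡ s · x
  reduce true s₀≡1 = begin
    dropCol s′ · dropCol x                           ≡⟨ cong (λ c → (c ∧ x zero) xor (dropCol s′ · dropCol x)) (cong₂ _xor_ s₀≡1 p₀≡1) ⟨
    (s′ zero ∧ x zero) xor (dropCol s′ · dropCol x)  ≡⟨ Σ₂-remove zero (λ j → s′ j ∧ x j) ⟨
    s′ · x                                           ≡⟨ ·-xorˡ s p x ⟩
    (s · x) xor (p · x)                              ≡⟨ cong ((s · x) xor_) p·x≡0 ⟩
    (s · x) xor false                                ≡⟨ xor-identityʳ (s · x) ⟩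
    s · x                                            ∎
  reduce false s₀≡0 = begin
    dropCol s · dropCol x                            ≡⟨ cong (λ c → (c ∧ x zero) xor (dropCol s · dropCol x)) s₀≡0 ⟨
    (s zero ∧ x zero) xor (dropCol s · dropCol x)    ≡⟨ Σ₂-remove zero (λ j → s j ∧ x j) ⟨
    s · x                                            ∎

solves-eliminate : (p : Vect (suc n)) (ps : List.List (Vect (suc n))) (x : Vect (suc n)) →
                   p zero ≡ true → p · x ≡ false → solves ps x ≡ solves (List.map (eliminate p) ps) (dropCol x)
solves-eliminate p List.[]        x p₀≡1 p·x≡0 = refl
solves-eliminate p (s List.∷ ps) x p₀≡1 p·x≡0 =
  cong₂ _∧_ (cong not (sym (eliminate-· p s x p₀≡1 p·x≡0))) (solves-eliminate p ps x p₀≡1 p·x≡0)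

solves-[] : (rs : List.List (Vect 0)) → solves rs (λ ()) ≡ true
solves-[] List.[]        = refl
solves-[] (_ List.∷ rs) = solves-[] rs

-- Exactly one value of the pivot coordinate extends a solution of the reduced system.
𝟙-pivot : ∀ d a → 𝟙 (not (true xor d) ∧ a) + 𝟙 (not (false xor d) ∧ a) ≡ 𝟙 a
𝟙-pivot false false = refl
𝟙-pivot false true  = refl
𝟙-pivot true  false = refl
𝟙-pivot true  true  = refl

solves-pivot : {rs : List.List (Vect (suc n))} {p : Vect (suc n)} {ps : List.List (Vect (suc n))} →
               p zero ≡ true → (∀ x → solves rs x ≡ solves (p List.∷ ps) x) →
               ∀ b x → solves rs (b ∷ x) ≡ not (b xor (dropCol p · x)) ∧ solves (List.map (eliminate p) ps) x
solves-pivot {rs = rs} {p} {ps} p₀≡1 rs≡ b x = begin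
  solves rs (b ∷ x)                                  ≡⟨ rs≡ (b ∷ x) ⟩
  not (p · (b ∷ x)) ∧ solves ps (b ∷ x)              ≡⟨ guard (p · (b ∷ x)) (solves-eliminate p ps (b ∷ x) p₀≡1) ⟩
  not (p · (b ∷ x)) ∧ solves ps′ x                   ≡⟨ cong (λ c → not c ∧ solves ps′ x) (trans (·-∷ p b x) (cong (λ c → (c ∧ b) xor (dropCol p · x)) p₀≡1)) ⟩
  not (b xor (dropCol p · x)) ∧ solves ps′ x         ∎
  where
  open ≡-Reasoning
  ps′ = List.map (eliminate p) ps
  guard : ∀ c {a a′} → (c ≡ false → a ≡ a′) → not c ∧ a ≡ not c ∧ a′
  guard true  _    = refl
  guard false a≡a′ = cong (true ∧_) (a≡a′ refl)

solutionCount-pivot : ∀ {m} {rs : List.List (Vect (suc m))} {p : Vect (suc m)} {ps : List.List (Vect (suc m))} →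
                      p zero ≡ true → (∀ x → solves rs x ≡ solves (p List.∷ ps) x) →
                      solutionCount (suc m) rs ≡ solutionCount m (List.map (eliminate p) ps)
solutionCount-pivot {m} {rs} {p} {ps} p₀≡1 rs≡ = begin
  ∑ᵥ m (λ x → 𝟙 (solves rs (true ∷ x))) + ∑ᵥ m (λ x → 𝟙 (solves rs (false ∷ x)))
    ≡⟨ cong₂ _+_ (∑ᵥ-cong (cong 𝟙 ∘ solves-pivot {rs = rs} {p} {ps} p₀≡1 rs≡ true)) (∑ᵥ-cong (cong 𝟙 ∘ solves-pivot {rs = rs} {p} {ps} p₀≡1 rs≡ false)) ⟩
  ∑ᵥ m (λ x → 𝟙 (on true x)) + ∑ᵥ m (λ x → 𝟙 (on false x))
    ≡⟨ ∑ᵥ-distrib-+ (λ x → 𝟙 (on true x)) (λ x → 𝟙 (on false x)) ⟨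
  ∑ᵥ m (λ x → 𝟙 (on true x) + 𝟙 (on false x))
    ≡⟨ ∑ᵥ-cong (λ x → 𝟙-pivot (dropCol p · x) (solves ps′ x)) ⟩
  solutionCount m ps′
    ∎
  where
  open ≡-Reasoning
  ps′ = List.map (eliminate p) ps
  on : Bool → Vect m → Bool
  on b x = not (b xor (dropCol p · x)) ∧ solves ps′ x

solutionCount-rank : ∀ m (rs : List.List (Vect m)) → solutionCount m rs * 2 ^ rankRows m rs ≡ 2 ^ m
solutionCount-rank zero rs = cong (λ b → 𝟙 b * 1) (solves-[] rs)
solutionCount-rank (suc m) rs with findPivot rs | pivotView rs
... | none | none rs≡ = begin
  solutionCount (suc m) rs * 2 ^ r                             ≡⟨ cong (_* 2 ^ r) count ⟩
  (solutionCount m rs′ + solutionCount m rs′) * 2 ^ r          ≡⟨ *-distribʳ-+ (2 ^ r) (solutionCount m rs′) _ ⟩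
  solutionCount m rs′ * 2 ^ r + solutionCount m rs′ * 2 ^ r    ≡⟨ cong₂ _+_ (solutionCount-rank m rs′) (solutionCount-rank m rs′) ⟩
  2 ^ m + 2 ^ m                                                ≡⟨ cong (2 ^ m +_) (+-identityʳ (2 ^ m)) ⟨
  2 ^ suc m                                                    ∎
  where
  open ≡-Reasoning
  rs′ = List.map dropCol rs
  r = rankRows m rs′
  count : solutionCount (suc m) rs ≡ solutionCount m rs′ + solutionCount m rs′
  count = cong₂ _+_ (∑ᵥ-cong (cong 𝟙 ∘ rs≡ true)) (∑ᵥ-cong (cong 𝟙 ∘ rs≡ false))
... | found p ps | found p₀≡1 rs≡ = begin
  solutionCount (suc m) rs * 2 ^ suc r      ≡⟨ cong (_* 2 ^ suc r) (solutionCount-pivot {rs = rs} {p} {ps} p₀≡1 rs≡) ⟩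
  solutionCount m ps′ * (2 * 2 ^ r)         ≡⟨ *-comm (solutionCount m ps′) (2 * 2 ^ r) ⟩
  2 * 2 ^ r * solutionCount m ps′           ≡⟨ *-assoc 2 (2 ^ r) _ ⟩
  2 * (2 ^ r * solutionCount m ps′)         ≡⟨ cong (2 *_) (trans (*-comm (2 ^ r) _) (solutionCount-rank m ps′)) ⟩
  2 ^ suc m                                 ∎
  where
  open ≡-Reasoning
  ps′ = List.map (eliminate p) ps
  r = rankRows m ps′

-- Kernels of principal submatrices

infix 5 _⊆_

_⊆_ : Subset n → Subset n → Bool
Z ⊆ X = ⋀ (λ i → not (Z i) ∨ X i)

⊆-sound : {Z X : Subset n} → Z ⊆ X ≡ true → ∀ i → Z i ≡ true → X i ≡ true
⊆-sound Z⊆X i Zi≡1 with ⋀-true Z⊆X i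
... | ¬Zi∨Xi rewrite Zi≡1 = ¬Zi∨Xi

⊆ᵇ≡⊆ : (Z X : Subset n) → Z ⊆ᵇ X ≡ Z ⊆ X
⊆ᵇ≡⊆ Z X = foldr-map-tabulate _∧_ true (λ i → not (Z i) ∨ X i) id

card-∷ : (X : Subset (suc n)) → card X ≡ 𝟙 (X zero) + card (X ∘ suc)
card-∷ X = trans (foldr-map-tabulate _+_ 0 (𝟙 ∘ X) id)
                 (cong (𝟙 (X zero) +_) (sym (foldr-map-tabulate _+_ 0 (𝟙 ∘ X ∘ suc) id)))

card-∁ : (X : Subset n) → card (not ∘ X) + card X ≡ n
card-∁ {zero}  X = refl
card-∁ {suc n} X = begin
  card (not ∘ X) + card X                                              ≡⟨ cong₂ _+_ (card-∷ (not ∘ X)) (card-∷ X) ⟩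
  (𝟙 (not (X zero)) + card (not ∘ X′)) + (𝟙 (X zero) + card X′)      ≡⟨ interchange (𝟙 (not (X zero))) _ _ _ ⟩
  (𝟙 (not (X zero)) + 𝟙 (X zero)) + (card (not ∘ X′) + card X′)      ≡⟨ cong₂ _+_ (one (X zero)) (card-∁ X′) ⟩
  suc n                                                                ∎
  where
  open ≡-Reasoning
  X′ = X ∘ suc
  one : ∀ b → 𝟙 (not b) + 𝟙 b ≡ 1
  one false = refl
  one true  = refl

-- Only the coordinates in X are seen by f, so each of the others contributes a factor 2.
∑ᵥ-restrict : (X : Subset n) (f : Vect n → ℕ) → f Preserves _≗_ ⟶ _≡_ →
              ∑ᵥ n (λ x → f (λ i → X i ∧ x i)) ≡ 2 ^ card (not ∘ X) * ∑ᵥ n (λ x → 𝟙 (x ⊆ X) * f x)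
∑ᵥ-restrict {zero}  X f f-ext = trans (f-ext λ ()) (sym (trans (+-identityʳ _) (+-identityʳ _)))
∑ᵥ-restrict {suc n} X f f-ext = begin
  ∑ᵥ n (λ x → f (λ i → X i ∧ (true ∷ x) i)) + ∑ᵥ n (λ x → f (λ i → X i ∧ (false ∷ x) i))
    ≡⟨ cong₂ _+_ (branch true) (branch false) ⟩
  2 ^ c′ * S (X zero ∧ true) + 2 ^ c′ * S (X zero ∧ false)
    ≡⟨ combine (X zero) ⟩
  2 ^ (𝟙 (not (X zero)) + c′) * (T (X zero) true + T (X zero) false)
    ≡⟨ cong (λ k → 2 ^ k * (T (X zero) true + T (X zero) false)) (card-∷ (not ∘ X)) ⟨
  2 ^ card (not ∘ X) * ∑ᵥ (suc n) (λ x → 𝟙 (x ⊆ X) * f x) ∎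
  where
  open ≡-Reasoning
  X′ = X ∘ suc
  c′ = card (not ∘ X′)
  S : Bool → ℕ
  S b = ∑ᵥ n (λ x → 𝟙 (x ⊆ X′) * f (b ∷ x))
  T : Bool → Bool → ℕ
  T c b = ∑ᵥ n (λ x → 𝟙 ((not b ∨ c) ∧ (x ⊆ X′)) * f (b ∷ x))
  ∷-ext : ∀ b → (λ x → f (b ∷ x)) Preserves _≗_ ⟶ _≡_
  ∷-ext b x≗y = f-ext λ { zero → refl ; (suc i) → x≗y i }
  branch : ∀ b → ∑ᵥ n (λ x → f (λ i → X i ∧ (b ∷ x) i)) ≡ 2 ^ c′ * S (X zero ∧ b)
  branch b = trans (∑ᵥ-cong {n} λ x → f-ext λ { zero → refl ; (suc i) → refl })
                   (∑ᵥ-restrict X′ (λ x → f ((X zero ∧ b) ∷ x)) (∷-ext (X zero ∧ b)))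
  combine : ∀ c → 2 ^ c′ * S (c ∧ true) + 2 ^ c′ * S (c ∧ false) ≡ 2 ^ (𝟙 (not c) + c′) * (T c true + T c false)
  combine true  = sym (*-distribˡ-+ (2 ^ c′) (S true) (S false))
  combine false = begin
    2 ^ c′ * S false + 2 ^ c′ * S false        ≡⟨ *-distribʳ-+ (S false) (2 ^ c′) (2 ^ c′) ⟨
    (2 ^ c′ + 2 ^ c′) * S false                ≡⟨ cong (λ k → (2 ^ c′ + k) * S false) (+-identityʳ (2 ^ c′)) ⟨
    2 ^ suc c′ * S false                       ≡⟨ cong (λ k → 2 ^ suc c′ * (k + S false)) (∑ᵥ-zero {n} (λ _ → refl)) ⟨
    2 ^ suc c′ * (T false true + S false)      ∎

infixr 7 _*ᵥ_

_*ᵥ_ : Mat n → Vect n → Vect n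
(M *ᵥ x) i = M i · x

-- x is supported on X and annihilated by the principal submatrix M[X]
kernelCondition : Mat n → Subset n → Vect n → Fin n → Bool
kernelCondition M X x i = if X i then not ((M *ᵥ x) i) else not (x i)

inKernel : Mat n → Subset n → Vect n → Bool
inKernel M X x = ⋀ (kernelCondition M X x)

kernelSize : Mat n → Subset n → ℕ
kernelSize {n} M X = ∑ᵥ n (λ x → 𝟙 (inKernel M X x))

solves-rows : (A : Mat n) (x : Vect n) → solves (List.map A (List.allFin n)) x ≡ ⋀ (λ i → not (A i · x))
solves-rows {n} A x = trans (cong and (sym (map-∘ (List.allFin n)))) (foldr-map-tabulate _∧_ true (λ i → not (A i · x)) id)

restrict-· : (M : Mat n) (X : Subset n) (i : Fin n) (x : Vect n) →
             restrict M X i · x ≡ restrict M X i · (λ j → X j ∧ x j)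
restrict-· M X i x = Σ₂-cong λ j → absorb (X i) (X j) (M i j) (x j)
  where
  absorb : ∀ a b m y → (a ∧ (b ∧ m)) ∧ y ≡ (a ∧ (b ∧ m)) ∧ (b ∧ y)
  absorb false b     m y = refl
  absorb true  false m y = refl
  absorb true  true  m y = refl

inKernel-⊆ : (M : Mat n) (X : Subset n) (x : Vect n) → inKernel M X x ≡ true → x ⊆ X ≡ true
inKernel-⊆ M X x ker = ⋀-intro λ i → supported (X i) (⋀-true ker i)
  where
  supported : ∀ {a c} b → (if b then c else not a) ≡ true → not a ∨ b ≡ true
  supported {false} false _ = refl
  supported {true}  false ()
  supported {false} true  _ = refl
  supported {true}  true  _ = refl

restrict-row : (M : Mat n) (X : Subset n) (x : Vect n) → x ⊆ X ≡ true →
               ∀ i → not (restrict M X i · x) ≡ kernelCondition M X x i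
restrict-row M X x x⊆X i =
  trans (cong not (trans (Σ₂-cong λ j → drop (X i) (X j) (M i j) (x j) (⊆-sound {Z = x} {X} x⊆X j))
                         (Σ₂-∧ˡ (X i) (λ j → M i j ∧ x j))))
        (by-cases (X i) refl)
  where
  drop : ∀ a b m y → (y ≡ true → b ≡ true) → (a ∧ (b ∧ m)) ∧ y ≡ a ∧ (m ∧ y)
  drop false b     m y     _ = refl
  drop true  true  m y     _ = refl
  drop true  false m false _ = sym (∧-zeroʳ m)
  drop true  false m true  y⇒b = contradiction (y⇒b refl) λ ()
  by-cases : ∀ c → X i ≡ c → not (c ∧ (M *ᵥ x) i) ≡ (if c then not ((M *ᵥ x) i) else not (x i))
  by-cases true  _     = refl
  by-cases false Xi≡0 with x i in xi≡
  ... | false = refl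
  ... | true  = contradiction (trans (sym (⊆-sound {Z = x} {X} x⊆X i xi≡)) Xi≡0) λ ()

m*2^r≡2^c⇒m≡2^[c∸r] : ∀ m r c → m * 2 ^ r ≡ 2 ^ c → m ≡ 2 ^ (c ∸ r)
m*2^r≡2^c⇒m≡2^[c∸r] m zero    c       eq = trans (sym (*-identityʳ m)) eq
m*2^r≡2^c⇒m≡2^[c∸r] m (suc r) zero    eq = contradiction (m*n≡1⇒m≡1 2 (2 ^ r) (m*n≡1⇒n≡1 m (2 ^ suc r) eq)) λ ()
m*2^r≡2^c⇒m≡2^[c∸r] m (suc r) (suc c) eq = m*2^r≡2^c⇒m≡2^[c∸r] m r c (*-cancelˡ-≡ _ _ 2 (begin
  2 * (m * 2 ^ r)  ≡⟨ *-assoc 2 m (2 ^ r) ⟨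
  2 * m * 2 ^ r    ≡⟨ cong (_* 2 ^ r) (*-comm 2 m) ⟩
  m * 2 * 2 ^ r    ≡⟨ *-assoc m 2 (2 ^ r) ⟩
  m * 2 ^ suc r    ≡⟨ eq ⟩
  2 ^ suc c        ∎))
  where open ≡-Reasoning

kernelSize-nullity : (M : Mat n) (X : Subset n) → kernelSize M X ≡ 2 ^ nullity M X
kernelSize-nullity {n} M X = m*2^r≡2^c⇒m≡2^[c∸r] (kernelSize M X) r (card X) (*-cancelˡ-≡ _ _ (2 ^ c) {{m^n≢0 2 c}} (begin
  2 ^ c * (kernelSize M X * 2 ^ r)    ≡⟨ *-assoc (2 ^ c) _ _ ⟨
  2 ^ c * kernelSize M X * 2 ^ r      ≡⟨ cong (_* 2 ^ r) padded ⟨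
  solutionCount n rows * 2 ^ r        ≡⟨ solutionCount-rank n rows ⟩
  2 ^ n                               ≡⟨ cong (2 ^_) (card-∁ X) ⟨
  2 ^ (c + card X)                    ≡⟨ ^-distribˡ-+-* 2 c (card X) ⟩
  2 ^ c * 2 ^ card X                  ∎))
  where
  open ≡-Reasoning
  rows = List.map (restrict M X) (List.allFin n)
  r = rank (restrict M X)
  c = card (not ∘ X)
  P : Vect n → Bool
  P x = ⋀ (λ i → not (restrict M X i · x))
  P-cong : (λ x → 𝟙 (P x)) Preserves _≗_ ⟶ _≡_
  P-cong x≗y = cong 𝟙 (⋀-cong λ i → cong not (Σ₂-cong λ j → cong (restrict M X i j ∧_) (x≗y j)))
  kernel : ∀ x → 𝟙 (x ⊆ X) * 𝟙 (P x) ≡ 𝟙 (inKernel M X x)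
  kernel x = trans (𝟙-* (x ⊆ X) (P x)) (cong 𝟙 (guarded (inKernel-⊆ M X x) λ x⊆X → ⋀-cong (restrict-row M X x x⊆X)))
    where
    guarded : ∀ {a b c} → (b ≡ true → a ≡ true) → (a ≡ true → c ≡ b) → a ∧ c ≡ b
    guarded {true}          _   a⇒c≡b = a⇒c≡b refl
    guarded {false} {false} _   _     = refl
    guarded {false} {true}  b⇒a _     = b⇒a refl
  padded : solutionCount n rows ≡ 2 ^ c * kernelSize M X
  padded = begin
    ∑ᵥ n (λ x → 𝟙 (solves rows x))                   ≡⟨ ∑ᵥ-cong (λ x → cong 𝟙 (trans (solves-rows (restrict M X) x) (⋀-cong λ i → cong not (restrict-· M X i x)))) ⟩
    ∑ᵥ n (λ x → 𝟙 (P (λ j → X j ∧ x j)))             ≡⟨ ∑ᵥ-restrict X (λ x → 𝟙 (P x)) P-cong ⟩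
    2 ^ c * ∑ᵥ n (λ x → 𝟙 (x ⊆ X) * 𝟙 (P x))         ≡⟨ cong (2 ^ c *_) (∑ᵥ-cong kernel) ⟩
    2 ^ c * kernelSize M X                           ∎

-- Q₁ as a sum over pairs, and loop complementation

2^-injective : ∀ a b → 2 ^ a ≡ 2 ^ b → a ≡ b
2^-injective a b eq = trans (sym (⌊log₂[2^n]⌋≡n a)) (trans (cong ⌊log₂_⌋ eq) (⌊log₂[2^n]⌋≡n b))

inKernel-cong : {M M′ : Mat n} {X X′ : Subset n} {x x′ : Vect n} →
                (∀ i → X i ≡ true → ∀ j → M i j ≡ M′ i j) → X ≗ X′ → x ≗ x′ → inKernel M X x ≡ inKernel M′ X′ x′
inKernel-cong {M = M} {M′} {X} {X′} {x} {x′} M≡M′ X≗X′ x≗x′ = ⋀-cong row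
  where
  row : ∀ i → (if X i then not ((M *ᵥ x) i) else not (x i)) ≡ (if X′ i then not ((M′ *ᵥ x′) i) else not (x′ i))
  row i with X i in Xi≡ | X′ i in X′i≡
  ... | true  | true  = cong not (Σ₂-cong λ j → cong₂ _∧_ (M≡M′ i Xi≡ j) (x≗x′ j))
  ... | false | false = cong not (x≗x′ i)
  ... | true  | false = contradiction (trans (sym Xi≡) (trans (X≗X′ i) X′i≡)) λ ()
  ... | false | true  = contradiction (trans (sym Xi≡) (trans (X≗X′ i) X′i≡)) λ ()

inKernel-congʳ : (M : Mat n) (X : Subset n) {x y : Vect n} → x ≗ y → inKernel M X x ≡ inKernel M X y
inKernel-congʳ M X = inKernel-cong {M = M} {X = X} (λ _ _ _ → refl) (λ _ → refl)

kernelSize-cong : {M M′ : Mat n} {X X′ : Subset n} →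
                  (∀ i → X i ≡ true → ∀ j → M i j ≡ M′ i j) → X ≗ X′ → kernelSize M X ≡ kernelSize M′ X′
kernelSize-cong {n} M≡M′ X≗X′ = ∑ᵥ-cong {n} λ x → cong 𝟙 (inKernel-cong M≡M′ X≗X′ (λ _ → refl))

⊆ᵇ-cong : {Z X Z′ X′ : Subset n} → (∀ i → not (Z i) ∨ X i ≡ not (Z′ i) ∨ X′ i) → Z ⊆ᵇ X ≡ Z′ ⊆ᵇ X′
⊆ᵇ-cong {Z = Z} {X} {Z′} {X′} eq = trans (⊆ᵇ≡⊆ Z X) (trans (⋀-cong eq) (sym (⊆ᵇ≡⊆ Z′ X′)))

Q₁-term : Mat n → ℕ → Subset n → Subset n → ℕ
Q₁-term G k X Z = if (Z ⊆ᵇ X) ∧ (nullity (G ⊕ Z) X ≡ᵇ k) then 1 else 0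

Q₁-term-≡ : ∀ {m} (G : Mat n) (G′ : Mat m) k {X Z : Subset n} {X′ Z′ : Subset m} → Z ⊆ᵇ X ≡ Z′ ⊆ᵇ X′ →
            (Z ⊆ᵇ X ≡ true → kernelSize (G ⊕ Z) X ≡ kernelSize (G′ ⊕ Z′) X′) → Q₁-term G k X Z ≡ Q₁-term G′ k X′ Z′
Q₁-term-≡ G G′ k {X} {Z} {X′} {Z′} ⊆≡⊆′ ker≡ker′ with Z ⊆ᵇ X | Z′ ⊆ᵇ X′
... | false | false = refl
... | true  | true  = cong (λ m → if m ≡ᵇ k then 1 else 0) (2^-injective (nullity (G ⊕ Z) X) (nullity (G′ ⊕ Z′) X′) (begin
  2 ^ nullity (G ⊕ Z) X       ≡⟨ kernelSize-nullity (G ⊕ Z) X ⟨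
  kernelSize (G ⊕ Z) X        ≡⟨ ker≡ker′ refl ⟩
  kernelSize (G′ ⊕ Z′) X′     ≡⟨ kernelSize-nullity (G′ ⊕ Z′) X′ ⟩
  2 ^ nullity (G′ ⊕ Z′) X′    ∎))
  where open ≡-Reasoning

Q₁-term-cong : (G : Mat n) (k : ℕ) {X Z X′ Z′ : Subset n} → X ≗ X′ → Z ≗ Z′ → Q₁-term G k X Z ≡ Q₁-term G k X′ Z′
Q₁-term-cong G k {X} {Z} {X′} {Z′} X≗X′ Z≗Z′ =
  Q₁-term-≡ G G k (⊆ᵇ-cong {Z = Z} {X} {Z′} {X′} λ i → cong₂ (λ z x → not z ∨ x) (Z≗Z′ i) (X≗X′ i))
                  (λ _ → kernelSize-cong (λ i _ j → cong (λ z → if ⌊ i ≟ j ⌋ ∧ z then not (G i j) else G i j) (Z≗Z′ i)) X≗X′)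

Q₁≡∑ᵥ : (G : Mat n) (k : ℕ) → Q₁ G k ≡ ∑ᵥ n (λ X → ∑ᵥ n (Q₁-term G k X))
Q₁≡∑ᵥ {n} G k = trans (cong sumᴸ (map-cong (λ X → ∑ᵥ-subsets (Q₁-term G k X) (Q₁-term-cong G k (λ _ → refl))) (subsets n)))
                      (∑ᵥ-subsets (λ X → ∑ᵥ n (Q₁-term G k X)) λ X≗X′ → ∑ᵥ-cong {n} λ Z → Q₁-term-cong G k X≗X′ (λ _ → refl))

⊕-⊕ : (G : Mat n) (Y Z : Subset n) → ∀ i j → ((G ⊕ Y) ⊕ Z) i j ≡ (G ⊕ (λ l → Y l xor Z l)) i j
⊕-⊕ G Y Z i j = toggle-twice ⌊ i ≟ j ⌋ (Y i) (Z i) (G i j)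
  where
  toggle-twice : ∀ d y z g → (if d ∧ z then not (if d ∧ y then not g else g) else (if d ∧ y then not g else g))
                             ≡ (if d ∧ (y xor z) then not g else g)
  toggle-twice false y     z     g = refl
  toggle-twice true  false z     g = refl
  toggle-twice true  true  false g = refl
  toggle-twice true  true  true  g = not-involutive g

Q₁-term-⊕ : (G : Mat n) (Y : Subset n) (k : ℕ) (X Z : Subset n) →
            Q₁-term (G ⊕ Y) k X Z ≡ Q₁-term G k X (λ i → Z i xor (Y i ∧ X i))
Q₁-term-⊕ G Y k X Z =
  Q₁-term-≡ (G ⊕ Y) G k (⊆ᵇ-cong {Z = Z} {X} {λ i → Z i xor (Y i ∧ X i)} {X} λ i → same-support (Z i) (X i) (Y i))
    (λ _ → kernelSize-cong (λ i Xi≡1 j → trans (⊕-⊕ G Y Z i j) (cong (toggle i j) (loops i Xi≡1))) (λ _ → refl))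
  where
  toggle : Fin _ → Fin _ → Bool → Bool
  toggle i j c = if ⌊ i ≟ j ⌋ ∧ c then not (G i j) else G i j
  same-support : ∀ z x y → not z ∨ x ≡ not (z xor (y ∧ x)) ∨ x
  same-support z     true  y     = trans (∨-zeroʳ (not z)) (sym (∨-zeroʳ _))
  same-support z     false false = cong (λ c → not c ∨ false) (sym (xor-identityʳ z))
  same-support false false true  = refl
  same-support true  false true  = refl
  loops : ∀ i → X i ≡ true → Y i xor Z i ≡ Z i xor (Y i ∧ X i)
  loops i Xi≡1 rewrite Xi≡1 | ∧-identityʳ (Y i) = xor-comm (Y i) (Z i)

Q₁-⊕ : (G : Mat n) (Y : Subset n) (k : ℕ) → Q₁ G k ≡ Q₁ (G ⊕ Y) k
Q₁-⊕ {n} G Y k = sym (begin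
  Q₁ (G ⊕ Y) k                                                          ≡⟨ Q₁≡∑ᵥ (G ⊕ Y) k ⟩
  ∑ᵥ n (λ X → ∑ᵥ n (Q₁-term (G ⊕ Y) k X))                               ≡⟨ ∑ᵥ-cong (λ X → ∑ᵥ-cong (Q₁-term-⊕ G Y k X)) ⟩
  ∑ᵥ n (λ X → ∑ᵥ n (λ Z → Q₁-term G k X (λ i → Z i xor (Y i ∧ X i))))   ≡⟨ ∑ᵥ-cong (λ X → ∑ᵥ-translate _ (Q₁-term G k X) (Q₁-term-cong G k (λ _ → refl))) ⟩
  ∑ᵥ n (λ X → ∑ᵥ n (Q₁-term G k X))                                     ≡⟨ Q₁≡∑ᵥ G k ⟨
  Q₁ G k                                                                ∎)
  where open ≡-Reasoning

-- Principal pivot transform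

⊕-*ᵥ : (G : Mat n) (Z : Subset n) (x : Vect n) (i : Fin n) → ((G ⊕ Z) *ᵥ x) i ≡ (G *ᵥ x) i xor (Z i ∧ x i)
⊕-*ᵥ G Z x i = begin
  Σ₂ (λ j → (G ⊕ Z) i j ∧ x j)                                 ≡⟨ Σ₂-cong (λ j → toggled ⌊ i ≟ j ⌋ (Z i) (G i j) (x j)) ⟩
  Σ₂ (λ j → (G i j ∧ x j) xor (⌊ i ≟ j ⌋ ∧ (Z i ∧ x j)))       ≡⟨ Σ₂-xor (λ j → G i j ∧ x j) (λ j → ⌊ i ≟ j ⌋ ∧ (Z i ∧ x j)) ⟩
  (G *ᵥ x) i xor Σ₂ (λ j → ⌊ i ≟ j ⌋ ∧ (Z i ∧ x j))            ≡⟨ cong ((G *ᵥ x) i xor_) (Σ₂-δ i (λ j → Z i ∧ x j)) ⟩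
  (G *ᵥ x) i xor (Z i ∧ x i)                                   ∎
  where
  open ≡-Reasoning
  toggled : ∀ d z g y → (if d ∧ z then not g else g) ∧ y ≡ (g ∧ y) xor (d ∧ (z ∧ y))
  toggled false z     g     y = sym (xor-identityʳ (g ∧ y))
  toggled true  false g     y = sym (xor-identityʳ (g ∧ y))
  toggled true  true  false y = refl
  toggled true  true  true  false = refl
  toggled true  true  true  true  = refl

if-split : ∀ y (a b : Bool) → (if y then a else b) ≡ (y ∧ a) xor (not y ∧ b)
if-split true  a b = sym (xor-identityʳ a)
if-split false a b = refl

Σ₂-if : (Y : Subset n) (f g : Fin n → Bool) →
        Σ₂ (λ j → if Y j then f j else g j) ≡ Σ₂[ Y ] f xor Σ₂ (λ j → not (Y j) ∧ g j)
Σ₂-if Y f g = trans (Σ₂-cong (λ j → if-split (Y j) (f j) (g j))) (Σ₂-xor (λ j → Y j ∧ f j) (λ j → not (Y j) ∧ g j))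

Σ₂-split : (Y : Subset n) (f : Fin n → Bool) → Σ₂ f ≡ Σ₂[ Y ] f xor Σ₂ (λ j → not (Y j) ∧ f j)
Σ₂-split Y f = trans (Σ₂-cong (λ j → sym (if-same (Y j) (f j)))) (Σ₂-if Y f f)
  where
  if-same : ∀ y (a : Bool) → (if y then a else a) ≡ a
  if-same true  a = refl
  if-same false a = refl

Σ₂-assoc : (Y : Subset n) (a : Fin n → Bool) (N : Mat n) (z : Vect n) →
           Σ₂[ Y ] (λ j → a j ∧ (N *ᵥ z) j) ≡ Σ₂ (λ l → Σ₂[ Y ] (λ j → a j ∧ N j l) ∧ z l)
Σ₂-assoc Y a N z = begin
  Σ₂ (λ j → Y j ∧ (a j ∧ Σ₂ (λ l → N j l ∧ z l)))      ≡⟨ Σ₂-cong (λ j → trans (sym (∧-assoc (Y j) (a j) _)) (sym (Σ₂-∧ˡ (Y j ∧ a j) (λ l → N j l ∧ z l)))) ⟩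
  Σ₂ (λ j → Σ₂ (λ l → (Y j ∧ a j) ∧ (N j l ∧ z l)))    ≡⟨ Σ₂-comm (λ j l → (Y j ∧ a j) ∧ (N j l ∧ z l)) ⟩
  Σ₂ (λ l → Σ₂ (λ j → (Y j ∧ a j) ∧ (N j l ∧ z l)))    ≡⟨ Σ₂-cong (λ l → trans (Σ₂-cong (λ j → regroup (Y j) (a j) (N j l) (z l))) (Σ₂-∧ʳ (z l) (λ j → Y j ∧ (a j ∧ N j l)))) ⟩
  Σ₂ (λ l → Σ₂ (λ j → Y j ∧ (a j ∧ N j l)) ∧ z l)      ∎
  where
  open ≡-Reasoning
  regroup : ∀ y a m z → (y ∧ a) ∧ (m ∧ z) ≡ (y ∧ (a ∧ m)) ∧ z
  regroup y a m z = trans (sym (∧-assoc (y ∧ a) m z)) (cong (_∧ z) (∧-assoc y a m))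

δ-outside : {Y : Subset n} {i l : Fin n} → Y i ≡ true → Y l ≡ false → ⌊ i ≟ l ⌋ ≡ false
δ-outside Yi≡1 Yl≡0 = ⌊≟⌋-≢ λ { refl → contradiction (trans (sym Yi≡1) Yl≡0) λ () }

δ-on : {Y : Subset n} {i : Fin n} (c : Fin n → Bool) → Y i ≡ true →
       (∀ l → Y l ≡ true → c l ≡ ⌊ i ≟ l ⌋) → ∀ l → Y l ∧ c l ≡ ⌊ i ≟ l ⌋
δ-on {Y = Y} c Yi≡1 c≡δ l with Y l in Yl≡
... | true  = c≡δ l Yl≡
... | false = sym (δ-outside {Y = Y} Yi≡1 Yl≡)

-- One kernel condition of (H + Z)[X] at a vertex with y = [i ∈ Y], a = (H z)ᵢ and b = zᵢ, rewritten as a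
-- condition of (G + Z)[X Δ (Y ∖ Z)] at the vector with aᵢ and bᵢ exchanged when i ∈ Y.
exchange-condition : ∀ y x z (a b : Bool) → (z ≡ true → x ≡ true) →
  (if x then not (a xor (z ∧ b)) else not b) ≡
  (if x xor (y ∧ not z) then not ((if y then b else a) xor (z ∧ (if y then a else b))) else not (if y then a else b))
exchange-condition false false z     a b _   = refl
exchange-condition false true  z     a b _   = refl
exchange-condition true  true  true  a b _   = cong not (xor-comm a b)
exchange-condition true  false true  a b z⇒x = contradiction (z⇒x refl) λ ()
exchange-condition true  true  false a b _   = cong not (xor-identityʳ a)
exchange-condition true  false false a b _   = cong not (sym (xor-identityʳ b))

module PivotTransform {n} (G : Mat n) (Y : Subset n) (B : Mat n) (inv : IsInverseOn G Y B) where

  H : Mat n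
  H = pivot G Y B

  BG GB GBG : Mat n
  BG i j  = Σ₂[ Y ] (λ k → B i k ∧ G k j)
  GB i j  = Σ₂[ Y ] (λ k → G i k ∧ B k j)
  GBG i j = Σ₂[ Y ] (λ k → G i k ∧ BG k j)

  H-row-in : ∀ {i} → Y i ≡ true → ∀ j → H i j ≡ (if Y j then B i j else BG i j)
  H-row-in {i} Yi≡1 j with Y i | Y j
  ... | true | true  = refl
  ... | true | false = refl

  H-row-out : ∀ {i} → Y i ≡ false → ∀ j → H i j ≡ (if Y j then GB i j else G i j xor GBG i j)
  H-row-out {i} Yi≡0 j with Y i | Y j
  ... | false | true  = refl
  ... | false | false = refl

  GBG-row-in : ∀ {i} → Y i ≡ true → ∀ l → GBG i l ≡ G i l
  GBG-row-in {i} Yi≡1 l = begin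
    Σ₂[ Y ] (λ k → G i k ∧ BG k l)                              ≡⟨ Σ₂-cong (λ k → cong (λ s → Y k ∧ (G i k ∧ s)) (Σ₂-cong λ m → sym (∧-swap (B k m) (Y m) (G m l)))) ⟩
    Σ₂[ Y ] (λ k → G i k ∧ (B *ᵥ (λ m → Y m ∧ G m l)) k)        ≡⟨ Σ₂-assoc Y (G i) B (λ m → Y m ∧ G m l) ⟩
    Σ₂ (λ m → GB i m ∧ (Y m ∧ G m l))                           ≡⟨ Σ₂-cong (λ m → trans (∧-swap (GB i m) (Y m) (G m l)) (sym (∧-assoc (Y m) (GB i m) (G m l)))) ⟩
    Σ₂ (λ m → (Y m ∧ GB i m) ∧ G m l)                           ≡⟨ Σ₂-cong (λ m → cong (_∧ G m l) (δ-on {Y = Y} (GB i) Yi≡1 (λ m Ym≡1 → proj₂ inv i m Yi≡1 Ym≡1) m)) ⟩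
    Σ₂ (λ m → ⌊ i ≟ m ⌋ ∧ G m l)                                ≡⟨ Σ₂-δ i (λ m → G m l) ⟩
    G i l                                                       ∎
    where open ≡-Reasoning

  -- The graph of H is that of G with the Y-coordinates of x and G x exchanged; ψ and φ perform the exchange.
  ψ φ : Vect n → Vect n
  ψ z j = if Y j then (H *ᵥ z) j else z j
  φ x j = if Y j then (G *ᵥ x) j else x j

  H-φ : ∀ x {i} → Y i ≡ true → (H *ᵥ φ x) i ≡ x i
  H-φ x {i} Yi≡1 = begin
    Σ₂ (λ j → H i j ∧ φ x j)                                          ≡⟨ Σ₂-cong (λ j → trans (cong (_∧ φ x j) (H-row-in Yi≡1 j)) (if-∧ (Y j))) ⟩
    Σ₂ (λ j → if Y j then B i j ∧ (G *ᵥ x) j else BG i j ∧ x j)       ≡⟨ Σ₂-if Y (λ j → B i j ∧ (G *ᵥ x) j) (λ j → BG i j ∧ x j) ⟩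
    Σ₂[ Y ] (λ j → B i j ∧ (G *ᵥ x) j) xor R                          ≡⟨ cong (_xor R) (Σ₂-assoc Y (B i) G x) ⟩
    Σ₂ (λ l → BG i l ∧ x l) xor R                                     ≡⟨ cong (_xor R) (Σ₂-split Y (λ l → BG i l ∧ x l)) ⟩
    (Σ₂[ Y ] (λ l → BG i l ∧ x l) xor R) xor R                        ≡⟨ xor-cancelʳ _ R ⟩
    Σ₂[ Y ] (λ l → BG i l ∧ x l)                                      ≡⟨ Σ₂-cong (λ l → trans (sym (∧-assoc (Y l) (BG i l) (x l)))
                                                                            (cong (_∧ x l) (δ-on {Y = Y} (BG i) Yi≡1 (λ l Yl≡1 → proj₁ inv i l Yi≡1 Yl≡1) l))) ⟩
    Σ₂ (λ l → ⌊ i ≟ l ⌋ ∧ x l)                                        ≡⟨ Σ₂-δ i x ⟩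
    x i                                                               ∎
    where
    open ≡-Reasoning
    R = Σ₂ (λ l → not (Y l) ∧ (BG i l ∧ x l))
    if-∧ : ∀ {a b c d} y → (if y then a else b) ∧ (if y then c else d) ≡ (if y then a ∧ c else b ∧ d)
    if-∧ true  = refl
    if-∧ false = refl

  C : Mat n
  C i l = if Y l then GB i l else GBG i l

  R : Vect n → Fin n → Bool
  R z i = Σ₂ (λ l → not (Y l) ∧ (G i l ∧ z l))

  G-ψ-expand : ∀ z i → (G *ᵥ ψ z) i ≡ (C *ᵥ z) i xor R z i
  G-ψ-expand z i = begin
    Σ₂ (λ j → G i j ∧ ψ z j)                                          ≡⟨ Σ₂-cong (λ j → ∧-if (Y j)) ⟩
    Σ₂ (λ j → if Y j then G i j ∧ (H *ᵥ z) j else G i j ∧ z j)        ≡⟨ Σ₂-if Y (λ j → G i j ∧ (H *ᵥ z) j) (λ j → G i j ∧ z j) ⟩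
    Σ₂[ Y ] (λ j → G i j ∧ (H *ᵥ z) j) xor R z i                      ≡⟨ cong (_xor R z i) (Σ₂-cong λ j → on-Y j (Y j) refl) ⟩
    Σ₂[ Y ] (λ j → G i j ∧ (C′ *ᵥ z) j) xor R z i                     ≡⟨ cong (_xor R z i) (Σ₂-assoc Y (G i) C′ z) ⟩
    Σ₂ (λ l → Σ₂[ Y ] (λ j → G i j ∧ C′ j l) ∧ z l) xor R z i         ≡⟨ cong (_xor R z i) (Σ₂-cong λ l → cong (_∧ z l) (GC′ l (Y l))) ⟩
    (C *ᵥ z) i xor R z i                                              ∎
    where
    open ≡-Reasoning
    C′ : Mat n
    C′ j l = if Y l then B j l else BG j l
    ∧-if : ∀ {g a b} y → g ∧ (if y then a else b) ≡ (if y then g ∧ a else g ∧ b)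
    ∧-if true  = refl
    ∧-if false = refl
    on-Y : ∀ j c → Y j ≡ c → Y j ∧ (G i j ∧ (H *ᵥ z) j) ≡ Y j ∧ (G i j ∧ (C′ *ᵥ z) j)
    on-Y j false Yj≡0 = trans (cong (_∧ (G i j ∧ (H *ᵥ z) j)) Yj≡0) (sym (cong (_∧ (G i j ∧ (C′ *ᵥ z) j)) Yj≡0))
    on-Y j true  Yj≡1 = cong (λ s → Y j ∧ (G i j ∧ s)) (Σ₂-cong λ l → cong (_∧ z l) (H-row-in Yj≡1 l))
    GC′ : ∀ l c → Σ₂[ Y ] (λ j → G i j ∧ (if c then B j l else BG j l)) ≡ (if c then GB i l else GBG i l)
    GC′ l true  = refl
    GC′ l false = refl

  G-ψ : ∀ z i → (G *ᵥ ψ z) i ≡ (if Y i then z i else (H *ᵥ z) i)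
  G-ψ z i = trans (G-ψ-expand z i) (by-cases (Y i) refl)
    where
    open ≡-Reasoning
    by-cases : ∀ c → Y i ≡ c → (C *ᵥ z) i xor R z i ≡ (if c then z i else (H *ᵥ z) i)
    by-cases true Yi≡1 = begin
      (C *ᵥ z) i xor R z i                                   ≡⟨ cong (_xor R z i) (Σ₂-cong C-in) ⟩
      Σ₂ (λ l → (⌊ i ≟ l ⌋ ∧ z l) xor (not (Y l) ∧ (G i l ∧ z l))) xor R z i
                                                             ≡⟨ cong (_xor R z i) (Σ₂-xor (λ l → ⌊ i ≟ l ⌋ ∧ z l) (λ l → not (Y l) ∧ (G i l ∧ z l))) ⟩
      (Σ₂ (λ l → ⌊ i ≟ l ⌋ ∧ z l) xor R z i) xor R z i       ≡⟨ xor-cancelʳ _ (R z i) ⟩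
      Σ₂ (λ l → ⌊ i ≟ l ⌋ ∧ z l)                             ≡⟨ Σ₂-δ i z ⟩
      z i                                                    ∎
      where
      C-in : ∀ l → C i l ∧ z l ≡ (⌊ i ≟ l ⌋ ∧ z l) xor (not (Y l) ∧ (G i l ∧ z l))
      C-in l with Y l in Yl≡
      ... | true  = trans (cong (_∧ z l) (proj₂ inv i l Yi≡1 Yl≡)) (sym (xor-identityʳ _))
      ... | false = trans (cong (_∧ z l) (GBG-row-in Yi≡1 l))
                          (cong (λ d → (d ∧ z l) xor (G i l ∧ z l)) (sym (δ-outside {Y = Y} Yi≡1 Yl≡)))
    by-cases false Yi≡0 = sym (begin
      Σ₂ (λ l → H i l ∧ z l)                                 ≡⟨ Σ₂-cong (λ l → trans (cong (_∧ z l) (H-row-out Yi≡0 l)) (C-out l (Y l))) ⟩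
      Σ₂ (λ l → (C i l ∧ z l) xor (not (Y l) ∧ (G i l ∧ z l)))
                                                             ≡⟨ Σ₂-xor (λ l → C i l ∧ z l) (λ l → not (Y l) ∧ (G i l ∧ z l)) ⟩
      (C *ᵥ z) i xor R z i                                   ∎)
      where
      C-out : ∀ l y → (if y then GB i l else G i l xor GBG i l) ∧ z l
                      ≡ ((if y then GB i l else GBG i l) ∧ z l) xor (not y ∧ (G i l ∧ z l))
      C-out l true  = sym (xor-identityʳ _)
      C-out l false = trans (∧-distribʳ-xor (z l) (G i l) (GBG i l)) (xor-comm (G i l ∧ z l) (GBG i l ∧ z l))

  φ-ψ : ∀ z → φ (ψ z) ≗ z
  φ-ψ z j = trans (cong (λ a → if Y j then a else ψ z j) (G-ψ z j)) (if-twice (Y j))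
    where
    if-twice : ∀ {a b : Bool} y → (if y then (if y then a else b) else (if y then b else a)) ≡ a
    if-twice true  = refl
    if-twice false = refl

  ψ-φ : ∀ x → ψ (φ x) ≗ x
  ψ-φ x j = by-cases (Y j) refl
    where
    by-cases : ∀ c → Y j ≡ c → (if c then (H *ᵥ φ x) j else (if c then (G *ᵥ x) j else x j)) ≡ x j
    by-cases true  Yj≡1 = H-φ x Yj≡1
    by-cases false _    = refl

  ψ-cong : ψ Preserves _≗_ ⟶ _≗_
  ψ-cong z≗z′ j = cong₂ (λ a b → if Y j then a else b) (Σ₂-cong λ l → cong (H j l ∧_) (z≗z′ l)) (z≗z′ j)

  φ-cong : φ Preserves _≗_ ⟶ _≗_
  φ-cong x≗x′ j = cong₂ (λ a b → if Y j then a else b) (Σ₂-cong λ l → cong (G j l ∧_) (x≗x′ l)) (x≗x′ j)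

  module _ {X Z : Subset n} (Z⊆X : ∀ i → Z i ≡ true → X i ≡ true) where

    X′ : Subset n
    X′ i = X i xor (Y i ∧ not (Z i))

    inKernel-pivot : ∀ z → inKernel (H ⊕ Z) X z ≡ inKernel (G ⊕ Z) X′ (ψ z)
    inKernel-pivot z = ⋀-cong λ i → begin
      (if X i then not (((H ⊕ Z) *ᵥ z) i) else not (z i))
        ≡⟨ cong (λ s → if X i then not s else not (z i)) (⊕-*ᵥ H Z z i) ⟩
      (if X i then not ((H *ᵥ z) i xor (Z i ∧ z i)) else not (z i))
        ≡⟨ exchange-condition (Y i) (X i) (Z i) ((H *ᵥ z) i) (z i) (Z⊆X i) ⟩
      (if X′ i then not ((if Y i then z i else (H *ᵥ z) i) xor (Z i ∧ ψ z i)) else not (ψ z i))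
        ≡⟨ cong (λ s → if X′ i then not (s xor (Z i ∧ ψ z i)) else not (ψ z i)) (G-ψ z i) ⟨
      (if X′ i then not ((G *ᵥ ψ z) i xor (Z i ∧ ψ z i)) else not (ψ z i))
        ≡⟨ cong (λ s → if X′ i then not s else not (ψ z i)) (⊕-*ᵥ G Z (ψ z) i) ⟨
      (if X′ i then not (((G ⊕ Z) *ᵥ ψ z) i) else not (ψ z i))
        ∎
      where open ≡-Reasoning

    kernelSize-pivot : kernelSize (H ⊕ Z) X ≡ kernelSize (G ⊕ Z) X′
    kernelSize-pivot = trans (∑ᵥ-cong (cong 𝟙 ∘ inKernel-pivot))
      (∑ᵥ-bijection (λ x → 𝟙 (inKernel (G ⊕ Z) X′ x)) (cong 𝟙 ∘ inKernel-congʳ (G ⊕ Z) X′)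
                    ψ φ ψ-cong φ-cong φ-ψ ψ-φ)

  Q₁-term-pivot : ∀ k X Z → Q₁-term H k X Z ≡ Q₁-term G k (λ i → X i xor (Y i ∧ not (Z i))) Z
  Q₁-term-pivot k X Z =
    Q₁-term-≡ H G k (⊆ᵇ-cong {Z = Z} {X} {Z} {λ i → X i xor (Y i ∧ not (Z i))} λ i → same-support (Z i) (X i) (Y i))
      λ Z⊆ᵇX → kernelSize-pivot (⊆-sound {Z = Z} {X} (trans (sym (⊆ᵇ≡⊆ Z X)) Z⊆ᵇX))
    where
    same-support : ∀ z x y → not z ∨ x ≡ not z ∨ (x xor (y ∧ not z))
    same-support false x y     = refl
    same-support true  x false = sym (xor-identityʳ x)
    same-support true  x true  = sym (xor-identityʳ x)

Q₁-pivot : (G : Mat n) (Y : Subset n) (B : Mat n) → IsInverseOn G Y B → ∀ k → Q₁ G k ≡ Q₁ (pivot G Y B) k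
Q₁-pivot {n} G Y B inv k = sym (begin
  Q₁ (pivot G Y B) k                                              ≡⟨ Q₁≡∑ᵥ (pivot G Y B) k ⟩
  ∑ᵥ n (λ X → ∑ᵥ n (Q₁-term (pivot G Y B) k X))                   ≡⟨ ∑ᵥ-cong (λ X → ∑ᵥ-cong (Q₁-term-pivot k X)) ⟩
  ∑ᵥ n (λ X → ∑ᵥ n (λ Z → Q₁-term G k (λ i → X i xor c Z i) Z))  ≡⟨ ∑ᵥ-comm (λ X Z → Q₁-term G k (λ i → X i xor c Z i) Z) ⟩
  ∑ᵥ n (λ Z → ∑ᵥ n (λ X → Q₁-term G k (λ i → X i xor c Z i) Z))  ≡⟨ ∑ᵥ-cong (λ Z → ∑ᵥ-translate (c Z) (λ X → Q₁-term G k X Z)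
                                                                                                  (λ X≗X′ → Q₁-term-cong G k X≗X′ (λ _ → refl))) ⟩
  ∑ᵥ n (λ Z → ∑ᵥ n (λ X → Q₁-term G k X Z))                       ≡⟨ ∑ᵥ-comm (λ Z X → Q₁-term G k X Z) ⟩
  ∑ᵥ n (λ X → ∑ᵥ n (Q₁-term G k X))                               ≡⟨ Q₁≡∑ᵥ G k ⟨
  Q₁ G k                                                          ∎)
  where
  open ≡-Reasoning
  open PivotTransform G Y B inv using (Q₁-term-pivot)
  c : Subset n → Subset n
  c Z i = Y i ∧ not (Z i)

-- Vertex deletion

insertAt-≗ : {w : Vect (suc n)} {u : Fin (suc n)} {a : Bool} {v : Vect n} →
             w u ≡ a → (∀ j → w (punchIn u j) ≡ v j) → w ≗ insertAt v u a
insertAt-≗ {w = w} {u} {a} {v} wu≡a w∘punchIn≗v i with u ≟ i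
... | yes refl = trans wu≡a (sym (insertAt-lookup v u a))
... | no u≢i   = begin
  w i                                      ≡⟨ cong w (punchIn-punchOut u≢i) ⟨
  w (punchIn u j)                          ≡⟨ w∘punchIn≗v j ⟩
  v j                                      ≡⟨ insertAt-punchIn v u a j ⟨
  insertAt v u a (punchIn u j)             ≡⟨ cong (insertAt v u a) (punchIn-punchOut u≢i) ⟩
  insertAt v u a i                         ∎
  where
  open ≡-Reasoning
  j = punchOut u≢i

insertAt-cong : (u : Fin (suc n)) (a : Bool) {v v′ : Vect n} → v ≗ v′ → insertAt v u a ≗ insertAt v′ u a
insertAt-cong u a {v} v≗v′ = insertAt-≗ (insertAt-lookup v u a) (λ j → trans (insertAt-punchIn v u a j) (v≗v′ j))

⌊punchIn≟punchIn⌋ : (u : Fin (suc n)) (i j : Fin n) → ⌊ punchIn u i ≟ punchIn u j ⌋ ≡ ⌊ i ≟ j ⌋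
⌊punchIn≟punchIn⌋ u i j with i ≟ j
... | yes refl = ⌊≟⌋-refl (punchIn u i)
... | no i≢j   = ⌊≟⌋-≢ (i≢j ∘ punchIn-injective u i j)

⊆-insertAt : (u : Fin (suc n)) (Z X : Subset n) (b a : Bool) → insertAt Z u b ⊆ insertAt X u a ≡ (not b ∨ a) ∧ (Z ⊆ X)
⊆-insertAt u Z X b a = trans (⋀-remove (λ i → not (insertAt Z u b i) ∨ insertAt X u a i))
  (cong₂ _∧_ (cong₂ (λ z x → not z ∨ x) (insertAt-lookup Z u b) (insertAt-lookup X u a))
             (⋀-cong λ j → cong₂ (λ z x → not z ∨ x) (insertAt-punchIn Z u b j) (insertAt-punchIn X u a j)))

kernelSize-delete : (M : Mat (suc n)) (u : Fin (suc n)) (X : Subset n) → kernelSize M (insertAt X u false) ≡ kernelSize (M ∖ u) X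
kernelSize-delete {n} M u X = begin
  kernelSize M X*                                                       ≡⟨ ∑ᵥ-insertAt u (λ x → 𝟙 (inKernel M X* x))
                                                                             (cong 𝟙 ∘ inKernel-congʳ M X*) ⟩
  ∑ᵥ n (λ x → 𝟙 (inKernel M X* (insertAt x u true))) + kernelSize′    ≡⟨ cong (_+ kernelSize′) (∑ᵥ-zero (λ x → cong 𝟙 (outside x))) ⟩
  kernelSize′                                                           ≡⟨ ∑ᵥ-cong (λ x → cong 𝟙 (inside x)) ⟩
  kernelSize (M ∖ u) X                                                  ∎
  where
  open ≡-Reasoning
  X* = insertAt X u false
  kernelSize′ = ∑ᵥ n (λ x → 𝟙 (inKernel M X* (insertAt x u false)))
  at-u : ∀ x a → kernelCondition M X* (insertAt x u a) u ≡ not a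
  at-u x a = trans (cong (λ c → if c then _ else not (insertAt x u a u)) (insertAt-lookup X u false))
                   (cong not (insertAt-lookup x u a))
  outside : ∀ x → inKernel M X* (insertAt x u true) ≡ false
  outside x = trans (⋀-remove (kernelCondition M X* (insertAt x u true))) (cong (_∧ ⋀ (removeAt (kernelCondition M X* (insertAt x u true)) u)) (at-u x true))
  row : ∀ x j → (M *ᵥ insertAt x u false) (punchIn u j) ≡ ((M ∖ u) *ᵥ x) j
  row x j = begin
    Σ₂ (λ l → M (punchIn u j) l ∧ insertAt x u false l)
      ≡⟨ Σ₂-remove u (λ l → M (punchIn u j) l ∧ insertAt x u false l) ⟩
    (M (punchIn u j) u ∧ insertAt x u false u) xor Σ₂ (λ l → M (punchIn u j) (punchIn u l) ∧ insertAt x u false (punchIn u l))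
      ≡⟨ cong₂ _xor_ (trans (cong (M (punchIn u j) u ∧_) (insertAt-lookup x u false)) (∧-zeroʳ _))
                     (Σ₂-cong λ l → cong (M (punchIn u j) (punchIn u l) ∧_) (insertAt-punchIn x u false l)) ⟩
    ((M ∖ u) *ᵥ x) j
      ∎
  inside : ∀ x → inKernel M X* (insertAt x u false) ≡ inKernel (M ∖ u) X x
  inside x = trans (⋀-remove (kernelCondition M X* (insertAt x u false)))
    (cong₂ _∧_ (at-u x false)
               (⋀-cong λ j → cong₃ (λ c s b → if c then not s else not b)
                                    (insertAt-punchIn X u false j) (row x j) (insertAt-punchIn x u false j)))


⊕-delete : (G : Mat (suc n)) (u : Fin (suc n)) (Z : Subset n) (b : Bool) →
           ∀ i j → ((G ∖ u) ⊕ Z) i j ≡ ((G ⊕ insertAt Z u b) ∖ u) i j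
⊕-delete G u Z b i j =
  cong₂ (λ d z → if d ∧ z then not ((G ∖ u) i j) else (G ∖ u) i j)
        (sym (⌊punchIn≟punchIn⌋ u i j)) (sym (insertAt-punchIn Z u b i))

Q₁-term-delete : (G : Mat (suc n)) (u : Fin (suc n)) (k : ℕ) (X Z : Subset n) →
              Q₁-term (G ∖ u) k X Z ≡ Q₁-term G k (insertAt X u false) (insertAt Z u false)
Q₁-term-delete G u k X Z = Q₁-term-≡ (G ∖ u) G k {X} {Z} {insertAt X u false} {insertAt Z u false}
  (trans (⊆ᵇ≡⊆ Z X) (sym (trans (⊆ᵇ≡⊆ (insertAt Z u false) (insertAt X u false)) (⊆-insertAt u Z X false false))))
  (λ _ → trans (kernelSize-cong (λ i _ → ⊕-delete G u Z false i) (λ _ → refl))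
               (sym (kernelSize-delete (G ⊕ insertAt Z u false) u X)))

Q₁-term-⊈ : (G : Mat (suc n)) (u : Fin (suc n)) (k : ℕ) (X Z : Subset n) →
         Q₁-term G k (insertAt X u false) (insertAt Z u true) ≡ 0
Q₁-term-⊈ G u k X Z =
  cong (λ c → if c ∧ (nullity (G ⊕ insertAt Z u true) (insertAt X u false) ≡ᵇ k) then 1 else 0) (trans (⊆ᵇ≡⊆ (insertAt Z u true) (insertAt X u false)) (⊆-insertAt u Z X true false))

xor-⟦⟧ : (u : Fin (suc n)) (v : Vect n) (a : Bool) (c : Vect (suc n)) {b : Bool} → c u ≡ b →
         (λ i → insertAt v u a i xor (⟦ u ⟧ i ∧ c i)) ≗ insertAt v u (a xor b)
xor-⟦⟧ u v a c cu≡b = insertAt-≗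
  (cong₃ (λ x d y → x xor (d ∧ y)) (insertAt-lookup v u a) (⌊≟⌋-refl u) cu≡b)
  (λ j → trans (cong₂ (λ x d → x xor (d ∧ c (punchIn u j))) (insertAt-punchIn v u a j) (⌊≟⌋-≢ (punchInᵢ≢i u j)))
               (xor-identityʳ (v j)))

Q₁-term-dual-pivot-delete : (G : Mat (suc n)) (u : Fin (suc n)) (B : Mat (suc n)) → IsInverseOn (G ⊕ ⟦ u ⟧) ⟦ u ⟧ B →
  ∀ k X Z → Q₁-term ((pivot (G ⊕ ⟦ u ⟧) ⟦ u ⟧ B ⊕ ⟦ u ⟧) ∖ u) k X Z ≡ Q₁-term G k (insertAt X u true) (insertAt Z u true)
Q₁-term-dual-pivot-delete G u B inv k X Z = begin
  Q₁-term ((P ⊕ ⟦ u ⟧) ∖ u) k X Z                                     ≡⟨ Q₁-term-delete (P ⊕ ⟦ u ⟧) u k X Z ⟩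
  Q₁-term (P ⊕ ⟦ u ⟧) k X₀ Z₀                                          ≡⟨ Q₁-term-⊕ P ⟦ u ⟧ k X₀ Z₀ ⟩
  Q₁-term P k X₀ (λ i → Z₀ i xor (⟦ u ⟧ i ∧ X₀ i))                    ≡⟨ Q₁-term-cong P k (λ _ → refl) (xor-⟦⟧ u Z false X₀ (insertAt-lookup X u false)) ⟩
  Q₁-term P k X₀ Z₀                                                    ≡⟨ Q₁-term-pivot k X₀ Z₀ ⟩
  Q₁-term (G ⊕ ⟦ u ⟧) k (λ i → X₀ i xor (⟦ u ⟧ i ∧ not (Z₀ i))) Z₀    ≡⟨ Q₁-term-cong (G ⊕ ⟦ u ⟧) k (xor-⟦⟧ u X false (not ∘ Z₀) (cong not (insertAt-lookup Z u false))) (λ _ → refl) ⟩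
  Q₁-term (G ⊕ ⟦ u ⟧) k X₁ Z₀                                          ≡⟨ Q₁-term-⊕ G ⟦ u ⟧ k X₁ Z₀ ⟩
  Q₁-term G k X₁ (λ i → Z₀ i xor (⟦ u ⟧ i ∧ X₁ i))                    ≡⟨ Q₁-term-cong G k (λ _ → refl) (xor-⟦⟧ u Z false X₁ (insertAt-lookup X u true)) ⟩
  Q₁-term G k X₁ (insertAt Z u true)                                   ∎
  where
  open ≡-Reasoning
  open PivotTransform (G ⊕ ⟦ u ⟧) ⟦ u ⟧ B inv using (Q₁-term-pivot)
  P = pivot (G ⊕ ⟦ u ⟧) ⟦ u ⟧ B
  X₀ = insertAt X u false
  Z₀ = insertAt Z u false
  X₁ = insertAt X u true

Q₁-term-pivot-delete : (G : Mat (suc n)) (u : Fin (suc n)) (Y : Subset (suc n)) (B : Mat (suc n)) → Y u ≡ true →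
  IsInverseOn G Y B → ∀ k X Z →
  Q₁-term (pivot G Y B ∖ u) k X Z ≡ Q₁-term G k (insertAt (λ j → X j xor (Y (punchIn u j) ∧ not (Z j))) u true) (insertAt Z u false)
Q₁-term-pivot-delete G u Y B Yu≡1 inv k X Z = begin
  Q₁-term (pivot G Y B ∖ u) k X Z                                ≡⟨ Q₁-term-delete (pivot G Y B) u k X Z ⟩
  Q₁-term (pivot G Y B) k X₀ Z₀                                  ≡⟨ Q₁-term-pivot k X₀ Z₀ ⟩
  Q₁-term G k (λ i → X₀ i xor (Y i ∧ not (Z₀ i))) Z₀             ≡⟨ Q₁-term-cong G k {Z = Z₀} {Z′ = Z₀} (insertAt-≗ at-u at-punchIn) (λ _ → refl) ⟩
  Q₁-term G k (insertAt (λ j → X j xor (Y (punchIn u j) ∧ not (Z j))) u true) Z₀ ∎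
  where
  open ≡-Reasoning
  open PivotTransform G Y B inv using (Q₁-term-pivot)
  X₀ = insertAt X u false
  Z₀ = insertAt Z u false
  at-u : X₀ u xor (Y u ∧ not (Z₀ u)) ≡ true
  at-u = cong₃ (λ x y z → x xor (y ∧ not z)) (insertAt-lookup X u false) Yu≡1 (insertAt-lookup Z u false)
  at-punchIn : ∀ j → X₀ (punchIn u j) xor (Y (punchIn u j) ∧ not (Z₀ (punchIn u j))) ≡ X j xor (Y (punchIn u j) ∧ not (Z j))
  at-punchIn j = cong₂ (λ x z → x xor (Y (punchIn u j) ∧ not z)) (insertAt-punchIn X u false j) (insertAt-punchIn Z u false j)

∑ᵥ²-insertAt : (u : Fin (suc n)) (F : Subset (suc n) → Subset (suc n) → ℕ) →
               (∀ {X X′ Z Z′} → X ≗ X′ → Z ≗ Z′ → F X Z ≡ F X′ Z′) →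
               let part : Bool → Bool → ℕ
                   part a b = ∑ᵥ n (λ X → ∑ᵥ n (λ Z → F (insertAt X u a) (insertAt Z u b)))
               in ∑ᵥ (suc n) (λ X → ∑ᵥ (suc n) (F X)) ≡ (part true true + part true false) + (part false true + part false false)
∑ᵥ²-insertAt {n} u F F-cong =
  trans (∑ᵥ-insertAt u (λ X → ∑ᵥ (suc n) (F X)) (λ X≗X′ → ∑ᵥ-cong {suc n} λ Z → F-cong {Z = Z} X≗X′ (λ _ → refl)))
        (cong₂ _+_ (split-Z true) (split-Z false))
  where
  split-Z : ∀ a → ∑ᵥ n (λ X → ∑ᵥ (suc n) (F (insertAt X u a))) ≡
                  ∑ᵥ n (λ X → ∑ᵥ n (λ Z → F (insertAt X u a) (insertAt Z u true))) +
                  ∑ᵥ n (λ X → ∑ᵥ n (λ Z → F (insertAt X u a) (insertAt Z u false)))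
  split-Z a = trans (∑ᵥ-cong λ X → ∑ᵥ-insertAt u (F (insertAt X u a)) (F-cong (λ _ → refl)))
                    (∑ᵥ-distrib-+ (λ X → ∑ᵥ n (λ Z → F (insertAt X u a) (insertAt Z u true)))
                                  (λ X → ∑ᵥ n (λ Z → F (insertAt X u a) (insertAt Z u false))))

Q₁-delete-vertex : (G : Mat (suc n)) (u : Fin (suc n)) (k : ℕ) →
  Q₁ (G ∖ u) k ≡ ∑ᵥ n (λ X → ∑ᵥ n (λ Z → Q₁-term G k (insertAt X u false) (insertAt Z u false)))
Q₁-delete-vertex G u k = trans (Q₁≡∑ᵥ (G ∖ u) k) (∑ᵥ-cong λ X → ∑ᵥ-cong (Q₁-term-delete G u k X))

Q₁-dual-pivot-delete : (G : Mat (suc n)) (u : Fin (suc n)) (B : Mat (suc n)) → IsInverseOn (G ⊕ ⟦ u ⟧) ⟦ u ⟧ B → ∀ k →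
  Q₁ ((pivot (G ⊕ ⟦ u ⟧) ⟦ u ⟧ B ⊕ ⟦ u ⟧) ∖ u) k ≡ ∑ᵥ n (λ X → ∑ᵥ n (λ Z → Q₁-term G k (insertAt X u true) (insertAt Z u true)))
Q₁-dual-pivot-delete G u B inv k =
  trans (Q₁≡∑ᵥ ((pivot (G ⊕ ⟦ u ⟧) ⟦ u ⟧ B ⊕ ⟦ u ⟧) ∖ u) k) (∑ᵥ-cong λ X → ∑ᵥ-cong (Q₁-term-dual-pivot-delete G u B inv k X))

Q₁-pivot-delete : (G : Mat (suc n)) (u : Fin (suc n)) (Y : Subset (suc n)) (B : Mat (suc n)) → Y u ≡ true →
  IsInverseOn G Y B → ∀ k →
  Q₁ (pivot G Y B ∖ u) k ≡ ∑ᵥ n (λ X → ∑ᵥ n (λ Z → Q₁-term G k (insertAt X u true) (insertAt Z u false)))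
Q₁-pivot-delete {n} G u Y B Yu≡1 inv k = begin
  Q₁ (pivot G Y B ∖ u) k                                 ≡⟨ Q₁≡∑ᵥ (pivot G Y B ∖ u) k ⟩
  ∑ᵥ n (λ X → ∑ᵥ n (Q₁-term (pivot G Y B ∖ u) k X))      ≡⟨ ∑ᵥ-cong (λ X → ∑ᵥ-cong (Q₁-term-pivot-delete G u Y B Yu≡1 inv k X)) ⟩
  ∑ᵥ n (λ X → ∑ᵥ n (λ Z → F (λ j → X j xor c Z j) Z))   ≡⟨ ∑ᵥ-comm (λ X Z → F (λ j → X j xor c Z j) Z) ⟩
  ∑ᵥ n (λ Z → ∑ᵥ n (λ X → F (λ j → X j xor c Z j) Z))   ≡⟨ ∑ᵥ-cong (λ Z → ∑ᵥ-translate (c Z) (λ X → F X Z) F-cong) ⟩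
  ∑ᵥ n (λ Z → ∑ᵥ n (λ X → F X Z))                       ≡⟨ ∑ᵥ-comm (λ Z X → F X Z) ⟩
  ∑ᵥ n (λ X → ∑ᵥ n (F X))                               ∎
  where
  open ≡-Reasoning
  F : Subset n → Subset n → ℕ
  F X Z = Q₁-term G k (insertAt X u true) (insertAt Z u false)
  c : Subset n → Subset n
  c Z j = Y (punchIn u j) ∧ not (Z j)
  F-cong : ∀ {X X′ Z} → X ≗ X′ → F X Z ≡ F X′ Z
  F-cong {Z = Z} X≗X′ = Q₁-term-cong G k {Z = insertAt Z u false} (insertAt-cong u true X≗X′) (λ _ → refl)

Q₁-delete : (G : Mat (suc n)) (u : Fin (suc n)) (B₁ : Mat (suc n)) → IsInverseOn (G ⊕ ⟦ u ⟧) ⟦ u ⟧ B₁ →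
            (Y : Subset (suc n)) (B₂ : Mat (suc n)) → Y u ≡ true → IsInverseOn G Y B₂ →
            ∀ k → Q₁ G k ≡ ((Q₁ (G ∖ u) +ₚ Q₁ ((pivot (G ⊕ ⟦ u ⟧) ⟦ u ⟧ B₁ ⊕ ⟦ u ⟧) ∖ u)) +ₚ Q₁ (pivot G Y B₂ ∖ u)) k
Q₁-delete {n} G u B₁ inv₁ Y B₂ Yu≡1 inv₂ k = begin
  Q₁ G k                                                 ≡⟨ Q₁≡∑ᵥ G k ⟩
  ∑ᵥ (suc n) (λ X → ∑ᵥ (suc n) (Q₁-term G k X))          ≡⟨ ∑ᵥ²-insertAt u (Q₁-term G k) (Q₁-term-cong G k) ⟩
  (part true true + part true false) + (part false true + part false false)
    ≡⟨ cong₂ _+_ (cong₂ _+_ (sym (Q₁-dual-pivot-delete G u B₁ inv₁ k)) (sym (Q₁-pivot-delete G u Y B₂ Yu≡1 inv₂ k)))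
                 (cong₂ _+_ (∑ᵥ-zero λ X → ∑ᵥ-zero (Q₁-term-⊈ G u k X)) (sym (Q₁-delete-vertex G u k))) ⟩
  (Q₁ D k + Q₁ P k) + (0 + Q₁ (G ∖ u) k)                 ≡⟨ +-comm (Q₁ D k + Q₁ P k) (Q₁ (G ∖ u) k) ⟩
  Q₁ (G ∖ u) k + (Q₁ D k + Q₁ P k)                       ≡⟨ +-assoc (Q₁ (G ∖ u) k) (Q₁ D k) (Q₁ P k) ⟨
  (Q₁ (G ∖ u) k + Q₁ D k) + Q₁ P k                       ∎
  where
  open ≡-Reasoning
  D = (pivot (G ⊕ ⟦ u ⟧) ⟦ u ⟧ B₁ ⊕ ⟦ u ⟧) ∖ u
  P = pivot G Y B₂ ∖ u
  part : Bool → Bool → ℕ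
  part a b = ∑ᵥ n (λ X → ∑ᵥ n (λ Z → Q₁-term G k (insertAt X u a) (insertAt Z u b)))

theorem36 :
  (∀ (n : ℕ) (G : Mat n) → Symmetric G → (Y : Subset n) → (B : Mat n) →
     IsInverseOn G Y B → ∀ k → Q₁ G k ≡ Q₁ (pivot G Y B) k)
  × (∀ (n : ℕ) (G : Mat n) → Symmetric G → (Y : Subset n) →
     ∀ k → Q₁ G k ≡ Q₁ (G ⊕ Y) k)
  × (∀ (n : ℕ) (G : Mat (suc n)) → Symmetric G → (u v : Fin (suc n)) →
     ¬ (u ≡ v) → G u v ≡ true → G u u ≡ false → G v v ≡ false →
     (B₁ : Mat (suc n)) → IsInverseOn (G ⊕ ⟦ u ⟧) ⟦ u ⟧ B₁ →
     (B₂ : Mat (suc n)) → IsInverseOn G ⟦ u , v ⟧ B₂ →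
     ∀ k → Q₁ G k ≡ ((Q₁ (G ∖ u) +ₚ Q₁ ((pivot (G ⊕ ⟦ u ⟧) ⟦ u ⟧ B₁ ⊕ ⟦ u ⟧) ∖ u))
                       +ₚ Q₁ (pivot G ⟦ u , v ⟧ B₂ ∖ u)) k)
theorem36 =
          (λ n G _ Y B inv → Q₁-pivot G Y B inv)
  Product., (λ n G _ Y → Q₁-⊕ G Y)
  Product., (λ n G _ u v _ _ _ _ B₁ inv₁ B₂ inv₂ →
       Q₁-delete G u B₁ inv₁ ⟦ u , v ⟧ B₂ (cong (_∨ ⌊ u ≟ v ⌋) (⌊≟⌋-refl u)) inv₂)
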